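{- Let $\mathbb{A}$ be a finite 3-conservative relational structure all of whose basic relations are unary or binary, and suppose $\mathbb{A}$ admits a Taylor operation. Then the variety generated by the algebra $(A,\mathrm{Pol}(\mathbb{A}))$ is congruence meet semidistributive ($SD(\wedge)$).
   Context: A relational structure $\mathbb{A}=(A,\{R_i\})$ is a set $A$ with relations $R_i\subseteq A^{n_i}$. An $n$-ary operation $f$ on $A$ preserves an $m$-ary relation $R$ if applying $f$ coordinatewise to any $n$ tuples of $R$ yields a tuple of $R$; $\mathrm{Pol}(\mathbb{A})$ is the set of all operations on $A$ preserving every basic relation of $\mathbb{A}$ (polymorphisms). $\mathbb{A}$ is 3-conservative if every subset of $A$ of size one, two or three is among its basic (unary) relations. An $n$-ary operation $t$ is Taylor if for every $1\le k\le n$ it satisfies some identity $t(u_1,\dots,u_{k-1},x,u_{k+1},\dots,u_n)\approx t(v_1,\dots,v_{k-1},y,v_{k+1},\dots,v_n)$ where the $u_i,v_i$ are variables and $x,y$ are distinct variables; $\mathbb{A}$ admits a Taylor operation if $\mathrm{Pol}(\mathbb{A})$ contains one. A variety is congruence meet semidistributive if for every algebra $\mathbf{B}$ in it and all congruences $\alpha,\beta,\gamma$ of $\mathbf{B}$, $\alpha\wedge\beta=\alpha\wedge\gamma$ implies $\alpha\wedge(\beta\vee\gamma)=\alpha\wedge\beta$. -}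

module Defs where

open import Level using (Level; _⊔_; Setω) renaming (suc to lsuc; zero to lzero)
open import Data.Nat using (ℕ)
open import Data.Fin using (Fin)
open import Data.Fin.Subset using (Subset; _∈_; ∣_∣)
open import Data.Vec using (Vec; lookup; map; tabulate)
open import Data.Vec.Relation.Binary.Pointwise.Inductive using (Pointwise)
open import Data.Product using (Σ; _×_; _,_; ∃)
open import Data.Sum using (_⊎_)
open import Relation.Binary using (Rel; IsEquivalence)
open import Relation.Binary.PropositionalEquality using (_≡_; _≢_)
open import Relation.Binary.Construct.Closure.Transitive using (TransClosure)
open import Relation.Binary.Construct.Union using (_∪_)

record RelStr (n : ℕ) : Set₁ where
  field
    Idx : Set
    ar  : Idx → ℕ
    rel : (i : Idx) → Vec (Fin n) (ar i) → Set

open RelStr public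

UnaryOrBinary : ∀ {n} → RelStr n → Set
UnaryOrBinary 𝔸 = ∀ i → ar 𝔸 i ≡ 1 ⊎ ar 𝔸 i ≡ 2

ThreeConservative : ∀ {n} → RelStr n → Set
ThreeConservative {n} 𝔸 =
  (S : Subset n) → (∣ S ∣ ≡ 1 ⊎ ∣ S ∣ ≡ 2 ⊎ ∣ S ∣ ≡ 3) →
  Σ (Idx 𝔸) λ i → (ar 𝔸 i ≡ 1) ×
    ((v : Vec (Fin n) (ar 𝔸 i)) →
       (rel 𝔸 i v → ∀ c → lookup v c ∈ S) × ((∀ c → lookup v c ∈ S) → rel 𝔸 i v))

Preserves : ∀ {n k m} → (Vec (Fin n) k → Fin n) → (Vec (Fin n) m → Set) → Set
Preserves {n} {k} {m} f R =
  (rows : Vec (Vec (Fin n) m) k) → (∀ j → R (lookup rows j)) →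
  R (tabulate λ c → f (map (λ r → lookup r c) rows))

record Pol {n} (𝔸 : RelStr n) : Set where
  constructor pol
  field
    arity    : ℕ
    op       : Vec (Fin n) arity → Fin n
    preserves : ∀ i → Preserves op (rel 𝔸 i)

open Pol public

-- Taylor: for every coordinate k some identity
--   t(u_1..x..u_n) ≈ t(v_1..y..v_n) with x ≠ y at position k holds in A.
-- Variables are natural numbers; an identity holds if it holds under every assignment.
IsTaylor : ∀ {n} {𝔸 : RelStr n} → Pol 𝔸 → Set
IsTaylor {n} t = (k : Fin (arity t)) →
  Σ (Vec ℕ (arity t)) λ u → Σ (Vec ℕ (arity t)) λ v →
    (lookup u k ≢ lookup v k) ×
    ((e : ℕ → Fin n) → op t (map e u) ≡ op t (map e v))

AdmitsTaylor : ∀ {n} → RelStr n → Set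
AdmitsTaylor 𝔸 = Σ (Pol 𝔸) IsTaylor

record Algebra {n} (𝔸 : RelStr n) (ℓ : Level) : Set (lsuc ℓ) where
  field
    Carrier : Set ℓ
    ⟦_⟧     : (p : Pol 𝔸) → Vec Carrier (arity p) → Carrier

open Algebra public

PolAlg : ∀ {n} (𝔸 : RelStr n) → Algebra 𝔸 lzero
PolAlg {n} 𝔸 = record { Carrier = Fin n ; ⟦_⟧ = op }

data Term {n} (𝔸 : RelStr n) : Set where
  var : ℕ → Term 𝔸
  app : (p : Pol 𝔸) → (Fin (arity p) → Term 𝔸) → Term 𝔸

eval : ∀ {n} {𝔸 : RelStr n} {ℓ} (B : Algebra 𝔸 ℓ) → (ℕ → Carrier B) → Term 𝔸 → Carrier B
eval B e (var x)    = e x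
eval B e (app p ts) = ⟦ B ⟧ p (tabulate λ j → eval B e (ts j))

Satisfies : ∀ {n} {𝔸 : RelStr n} {ℓ} → Algebra 𝔸 ℓ → Term 𝔸 → Term 𝔸 → Set ℓ
Satisfies B s t = (e : ℕ → Carrier B) → eval B e s ≡ eval B e t

-- B lies in the variety generated by (A, Pol(𝔸)):
-- B satisfies every identity satisfied by (A, Pol(𝔸))   (Birkhoff: V = HSP = Mod Id)
InVariety : ∀ {n} {𝔸 : RelStr n} {ℓ} → Algebra 𝔸 ℓ → Set ℓ
InVariety {𝔸 = 𝔸} B = (s t : Term 𝔸) → Satisfies (PolAlg 𝔸) s t → Satisfies B s t

record Congruence {n} {𝔸 : RelStr n} {ℓ} (B : Algebra 𝔸 ℓ) : Set (lsuc ℓ) where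
  field
    θ     : Rel (Carrier B) ℓ
    isEq  : IsEquivalence θ
    compat : (p : Pol 𝔸) (xs ys : Vec (Carrier B) (arity p)) →
             Pointwise θ xs ys → θ (⟦ B ⟧ p xs) (⟦ B ⟧ p ys)

open Congruence public

_∧ᶜ_ : ∀ {a ℓ} {C : Set a} → Rel C ℓ → Rel C ℓ → Rel C ℓ
(R ∧ᶜ S) x y = R x y × S x y

_∨ᶜ_ : ∀ {a ℓ} {C : Set a} → Rel C ℓ → Rel C ℓ → Rel C (a ⊔ ℓ)
R ∨ᶜ S = TransClosure (R ∪ S)

_≐_ : ∀ {a ℓ₁ ℓ₂} {C : Set a} → Rel C ℓ₁ → Rel C ℓ₂ → Set (a ⊔ ℓ₁ ⊔ ℓ₂)
R ≐ S = (∀ {x y} → R x y → S x y) × (∀ {x y} → S x y → R x y)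

VarietySDmeet : ∀ {n} → RelStr n → Setω
VarietySDmeet 𝔸 = ∀ {ℓ} (B : Algebra 𝔸 ℓ) → InVariety B →
  (α β γ : Congruence B) →
  (θ α ∧ᶜ θ β) ≐ (θ α ∧ᶜ θ γ) →
  (θ α ∧ᶜ (θ β ∨ᶜ θ γ)) ≐ (θ α ∧ᶜ θ β)

{-# OPTIONS --safe #-}
module Submission where

open import Data.Bool using (Bool; true; false; not; _∧_)
open import Data.Bool.Properties using () renaming (_≟_ to _≟ᵇ_)
open import Data.Empty using (⊥; ⊥-elim)
open import Data.Fin using (Fin; zero; suc)
open import Data.Fin.Patterns using (0F; 1F; 2F)
open import Data.Fin.Properties using (_≟_)
open import Data.Fin.Subset using (Subset; ⁅_⁆; _∪_; ∣_∣) renaming (_∈_ to _∈ˢ_)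
open import Data.Fin.Subset.Properties using (∣⁅x⁆∣≡1; ∣p∣≤∣p∪q∣; ∪-identityˡ; x∈p∪q⁻; x∈p∪q⁺; x∈⁅x⁆; x∈⁅y⁆⇒x≡y)
open import Data.List using (List; []; _∷_; allFin; cartesianProduct)
open import Data.List.Membership.Propositional using (_∈_)
open import Data.List.Membership.Propositional.Properties using (∈-allFin; ∈-cartesianProduct⁺)
open import Data.List.Relation.Unary.Any using (here; there)
open import Data.Nat using (ℕ; zero; suc; _≤_; s≤s) renaming (_≟_ to _≟ⁿ_)
open import Data.Nat.Properties using (≤-refl; ≤-trans; ≤-reflexive; m≤n⇒m≤1+n)
open import Data.Product as Product using (Σ; _×_; _,_; proj₁; proj₂)
open import Data.Sum as Sum using (_⊎_; inj₁; inj₂)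
open import Data.Vec using (Vec; []; _∷_; lookup; map; tabulate)
open import Data.Vec.Properties using (lookup∘tabulate; tabulate∘lookup; tabulate-∘; tabulate-cong)
open import Data.Vec.Relation.Binary.Pointwise.Inductive using ([]; _∷_)
open import Function using (id; _∘_; flip)
open import Relation.Binary using (IsEquivalence)
open import Relation.Binary.Construct.Closure.Transitive using ([_]; _∷_; symmetric)
open import Relation.Binary.PropositionalEquality using (_≡_; _≢_; refl; sym; trans; cong; cong₂; subst; subst₂)
open import Relation.Nullary using (Dec; yes; no; ¬_; does)
open import Relation.Nullary.Decidable using (map′; _×-dec_; from-yes; dec-true; dec-false)
open import Defs

-- Let t be the Taylor polymorphism. Everything happens in the clone of the operations that preserve the
-- invariant binary relations of t; those are polymorphisms because all relations are unary or binary.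
--
-- By the argument behind Post's classification, on every pair {a, b} this clone contains a semilattice,
-- the majority or the minority operation, and these glue to global f, g, h. Bulatov's colours: f is
-- commutative on red pairs, g is majority on yellow pairs, h is minority on blue pairs. On blue pairs one
-- can nevertheless define an operation M of the clone that is majority there as well. Applying f
-- repeatedly to a triple removes the red pairs among its entries, so it suffices to define M on triples
-- without red pairs: there M is g if at least two of the edges are yellow, and one of the entries otherwise.
-- A yellow and a blue pair are always independent in an invariant relation, which makes the
-- choices of M compatible.
--
-- Finally, with F(x, y) = M(x, x, y), the identities of M carry relations modulo α ∧ β along a
-- chain of β- and γ-steps, and this yields meet semidistributivity.

-- Idempotent self-dual Boolean operations of three variables.

BoolOp₃ : Set
BoolOp₃ = Bool → Bool → Bool → Bool

-- When the i-th argument differs from the two others, it is returned if bᵢ holds, and the repeated value is returned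
-- otherwise.
pattern₃ : Bool → Bool → Bool → BoolOp₃
pattern₃ b₁ b₂ b₃ true  true  true  = true
pattern₃ b₁ b₂ b₃ true  false false = b₁
pattern₃ b₁ b₂ b₃ false true  true  = not b₁
pattern₃ b₁ b₂ b₃ false true  false = b₂
pattern₃ b₁ b₂ b₃ true  false true  = not b₂
pattern₃ b₁ b₂ b₃ false false true  = b₃
pattern₃ b₁ b₂ b₃ true  true  false = not b₃
pattern₃ b₁ b₂ b₃ false false false = false

maj min π₁ π₂ π₃ : BoolOp₃
maj = pattern₃ false false false
min = pattern₃ true true true
π₁  = pattern₃ true false false
π₂  = pattern₃ false true false
π₃  = pattern₃ false false true

all₁? : {P : Bool → Set} → (∀ u → Dec (P u)) → Dec (∀ u → P u)
all₁? P? = map′ (λ { (p , q) true → p ; (p , q) false → q }) (λ p → p true , p false)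
                (P? true ×-dec P? false)

_≗₃_ : BoolOp₃ → BoolOp₃ → Set
κ ≗₃ μ = ∀ u v w → κ u v w ≡ μ u v w

_≗₃?_ : ∀ κ μ → Dec (κ ≗₃ μ)
κ ≗₃? μ = all₁? λ u → all₁? λ v → all₁? λ w → κ u v w ≟ᵇ μ u v w

rotate : {C : Set} → (C → C → C → C) → (C → C → C → C) → C → C → C → C
rotate s q x y z = s (q x y z) (q y z x) (q z x y)

-- A term, found by computer search, that turns the patterns with two true entries into majority or
-- minority, and each projection into the first one, while fixing majority and minority.
normal : {C : Set} → (C → C → C → C) → C → C → C → C
normal q x y z = q (q x y (q x y z)) (q x x (q x y y)) (q x z (q y z x))

normal-maj : normal maj ≗₃ maj
normal-maj = from-yes (normal maj ≗₃? maj)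

normal-min : normal min ≗₃ min
normal-min = from-yes (normal min ≗₃? min)

Normalised : BoolOp₃ → Set
Normalised κ = (normal κ ≗₃ maj ⊎ normal κ ≗₃ min) ⊎ normal κ ≗₃ π₁

-- Which projection occurs is remembered, because the Taylor argument distinguishes all three,
-- although `normal` sends each of them to the first one.
data Class (κ : BoolOp₃) : Set where
  is-π₁ : κ ≗₃ π₁ → normal κ ≗₃ π₁ → Class κ
  is-π₂ : κ ≗₃ π₂ → normal κ ≗₃ π₁ → Class κ
  is-π₃ : κ ≗₃ π₃ → normal κ ≗₃ π₁ → Class κ
  non-projection : normal κ ≗₃ maj ⊎ normal κ ≗₃ min → Class κ

classify : ∀ b₁ b₂ b₃ → Class (pattern₃ b₁ b₂ b₃)
classify true  false false = is-π₁ (λ _ _ _ → refl) (from-yes (normal π₁ ≗₃? π₁))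
classify false true  false = is-π₂ (λ _ _ _ → refl) (from-yes (normal π₂ ≗₃? π₁))
classify false false true  = is-π₃ (λ _ _ _ → refl) (from-yes (normal π₃ ≗₃? π₁))
classify false false false = non-projection (inj₁ normal-maj)
classify true  true  true  = non-projection (inj₂ normal-min)
classify true  true  false = non-projection (inj₁ (from-yes (normal (pattern₃ true true false) ≗₃? maj)))
classify true  false true  = non-projection (inj₂ (from-yes (normal (pattern₃ true false true) ≗₃? min)))
classify false true  true  = non-projection (inj₁ (from-yes (normal (pattern₃ false true true) ≗₃? maj)))

normalised : ∀ {κ} → Class κ → Normalised κ
normalised (is-π₁ _ e) = inj₂ e
normalised (is-π₂ _ e) = inj₂ e
normalised (is-π₃ _ e) = inj₂ e
normalised (non-projection e) = inj₁ e

-- Ternary operations acting on a pair as Boolean operations.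

at : {C : Set} → C → C → Bool → C
at a b true  = a
at a b false = b

record Acts {C : Set} (q : C → C → C → C) (a b : C) (κ : BoolOp₃) : Set where
  constructor acts
  field act : ∀ u v w → q (at a b u) (at a b v) (at a b w) ≡ at a b (κ u v w)

open Acts

module _ {C : Set} {q : C → C → C → C} {a b : C} where

  acts-cong : ∀ {κ μ} → Acts q a b κ → κ ≗₃ μ → Acts q a b μ
  acts-cong (acts h) e = acts λ u v w → trans (h u v w) (cong (at a b) (e u v w))

  -- Since `q` maps the pair into itself, the nested term can be evaluated from the inside out.
  acts-normal : ∀ {κ} → Acts q a b κ → Acts (normal q) a b (normal κ)
  acts-normal {κ} (acts h) = acts lemma
    where
    lemma : ∀ u v w → normal q (at a b u) (at a b v) (at a b w) ≡ at a b (normal κ u v w)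
    lemma u v w
      rewrite h u v w | h u v v | h v w u
            | h u v (κ u v w) | h u u (κ u v v) | h u w (κ v w u)
      = h _ _ _

acts-normalised : {C : Set} {q : C → C → C → C} {a b : C} → ∀ {κ} → Acts q a b κ → Normalised κ →
  (Acts (normal q) a b maj ⊎ Acts (normal q) a b min) ⊎ Acts (normal q) a b π₁
acts-normalised h (inj₁ (inj₁ e)) = inj₁ (inj₁ (acts-cong (acts-normal h) e))
acts-normalised h (inj₁ (inj₂ e)) = inj₁ (inj₂ (acts-cong (acts-normal h) e))
acts-normalised h (inj₂ e) = inj₂ (acts-cong (acts-normal h) e)

Comm Fixes : {C : Set} → (C → C → C) → C → C → Set
Comm  f a b = f a b ≡ f b a
Fixes f a b = f a b ≡ a × f b a ≡ b

minor₁ minor₂ minor₃ : {C : Set} → (C → C → C → C) → C → C → C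
minor₁ q x y = q x y y
minor₂ q x y = q y x y
minor₃ q x y = q y y x

-- Invariant binary relations and conservative operations.

module Clone {n k : ℕ} (t : (Fin k → Fin n) → Fin n) where

  A : Set
  A = Fin n

  -- Unary relations are covered too, as binary relations that ignore one coordinate; conservativity
  -- is expressed in this way.
  record Inv (R : A → A → Set) : Set where
    constructor inv
    field closed : ∀ v v′ → (∀ j → R (v j) (v′ j)) → R (t v) (t v′)

  open Inv public

  -- Invariant binary relations only: this is the clone of the operations preserving all of them,
  -- which contains t but is in general larger than the clone generated by t.
  Pres₂ : (A → A → A) → Set₁
  Pres₂ f = ∀ {R} → Inv R → ∀ {a a′ b b′} → R a a′ → R b b′ → R (f a b) (f a′ b′)

  Pres₃ : (A → A → A → A) → Set₁
  Pres₃ q = ∀ {R} → Inv R → ∀ {a a′ b b′ c c′} →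
            R a a′ → R b b′ → R c c′ → R (q a b c) (q a′ b′ c′)

  OneOf : A → A → A → A → Set
  OneOf x y z a = a ≡ x ⊎ a ≡ y ⊎ a ≡ z

  normal-pres : ∀ {q} → Pres₃ q → Pres₃ (normal q)
  normal-pres p I x y z =
    p I (p I x y (p I x y z)) (p I x x (p I x y y)) (p I x z (p I y z x))

  rotate-pres : ∀ {s q} → Pres₃ s → Pres₃ q → Pres₃ (rotate s q)
  rotate-pres ps pq I x y z = ps I (pq I x y z) (pq I y z x) (pq I z x y)

  module Conservative (cons : ∀ x y z → Inv (λ a _ → OneOf x y z a)) where

    one-of-two : ∀ {x y a : A} → OneOf x y y a → a ≡ x ⊎ a ≡ y
    one-of-two (inj₁ e)        = inj₁ e
    one-of-two (inj₂ (inj₁ e)) = inj₂ e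
    one-of-two (inj₂ (inj₂ e)) = inj₂ e

    cons₂ : ∀ {f} → Pres₂ f → ∀ a b → f a b ≡ a ⊎ f a b ≡ b
    cons₂ p a b = one-of-two (p (cons a b b) {a} {a} {b} {b} (inj₁ refl) (inj₂ (inj₁ refl)))

    cons₃ : ∀ {q} → Pres₃ q → ∀ a b c → OneOf a b c (q a b c)
    cons₃ p a b c = p (cons a b c) {a} {a} {b} {b} {c} {c}
                      (inj₁ refl) (inj₂ (inj₁ refl)) (inj₂ (inj₂ refl))

    idem₂ : ∀ {f} → Pres₂ f → ∀ a → f a a ≡ a
    idem₂ p a with cons₂ p a a
    ... | inj₁ e = e
    ... | inj₂ e = e

    idem₃ : ∀ {q} → Pres₃ q → ∀ a → q a a a ≡ a
    idem₃ {q} p = idem₂ {λ x y → q x y y} λ I x y → p I x y y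

    cons-at : ∀ a b (S : Fin k → Bool) → t (at a b ∘ S) ≡ a ⊎ t (at a b ∘ S) ≡ b
    cons-at a b S = one-of-two (closed (cons a b b) _ (at a b ∘ S) (λ j → in-pair (S j)))
      where
      in-pair : ∀ c → OneOf a b b (at a b c)
      in-pair true  = inj₁ refl
      in-pair false = inj₂ (inj₁ refl)

    -- A conservative operation that does not commute on a pair is one of the two projections there,
    -- hence described by a single bit.
    noncomm : ∀ {m} → Pres₂ m → ∀ {a b} → ¬ Comm m a b →
      Σ Bool λ c → m a b ≡ at a b c × m b a ≡ at a b (not c)
    noncomm p {a} {b} ¬c with cons₂ p a b | cons₂ p b a
    ... | inj₁ e | inj₁ e′ = true , e , e′
    ... | inj₂ e | inj₂ e′ = false , e , e′
    ... | inj₁ e | inj₂ e′ = ⊥-elim (¬c (trans e (sym e′)))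
    ... | inj₂ e | inj₁ e′ = ⊥-elim (¬c (trans e (sym e′)))

    module _ {q : A → A → A → A} (p : Pres₃ q) where

      minor₁-pres : Pres₂ (minor₁ q)
      minor₁-pres I x y = p I x y y

      minor₂-pres : Pres₂ (minor₂ q)
      minor₂-pres I x y = p I y x y

      minor₃-pres : Pres₂ (minor₃ q)
      minor₃-pres I x y = p I y y x

      -- Idempotence settles the constant triples, and each minor, being a projection on the pair,
      -- contributes one bit and its dual value.
      acts-pattern : ∀ {a b} →
        ¬ Comm (minor₁ q) a b → ¬ Comm (minor₂ q) a b → ¬ Comm (minor₃ q) a b →
        Σ BoolOp₃ λ κ → Acts q a b κ × Class κ
      acts-pattern {a} {b} ¬c₁ ¬c₂ ¬c₃
        with noncomm minor₁-pres ¬c₁ | noncomm minor₂-pres ¬c₂ | noncomm minor₃-pres ¬c₃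
      ... | b₁ , e₁ , e₁′ | b₂ , e₂ , e₂′ | b₃ , e₃ , e₃′ =
        pattern₃ b₁ b₂ b₃ , acts lemma , classify b₁ b₂ b₃
        where
        lemma : ∀ u v w → q (at a b u) (at a b v) (at a b w) ≡ at a b (pattern₃ b₁ b₂ b₃ u v w)
        lemma true  true  true  = idem₃ p a
        lemma true  false false = e₁
        lemma false true  true  = e₁′
        lemma false true  false = e₂
        lemma true  false true  = e₂′
        lemma false false true  = e₃
        lemma true  true  false = e₃′
        lemma false false false = idem₃ p b

    -- For distinct elements these are the nontrivial cases of Post's analysis: a commutative
    -- operation is a semilattice on the pair, and the other case leads to majority or minority. The
    -- operation is kept unnormalised, since the gluing normalises after composing.
    data Useful (a b : A) : Set₁ where
      commutative : ∀ {m} → Pres₂ m → Comm m a b → Useful a b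
      non-projection : ∀ {s κ} → Pres₃ s → Acts s a b κ →
        normal κ ≗₃ maj ⊎ normal κ ≗₃ min → Useful a b

    data Projection (q : A → A → A → A) (a b : A) : Set where
      is-π₁ : Acts q a b π₁ → Projection q a b
      is-π₂ : Acts q a b π₂ → Projection q a b
      is-π₃ : Acts q a b π₃ → Projection q a b

    probe : ∀ {q} → Pres₃ q → ∀ a b → Useful a b ⊎ Projection q a b
    probe {q} p a b with minor₁ q a b ≟ minor₁ q b a | minor₂ q a b ≟ minor₂ q b a | minor₃ q a b ≟ minor₃ q b a
    ... | yes c | _ | _ = inj₁ (commutative (minor₁-pres p) c)
    ... | no _ | yes c | _ = inj₁ (commutative (minor₂-pres p) c)
    ... | no _ | no _ | yes c = inj₁ (commutative (minor₃-pres p) c)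
    ... | no ¬c₁ | no ¬c₂ | no ¬c₃ with acts-pattern p ¬c₁ ¬c₂ ¬c₃
    ... | κ , h , is-π₁ e _ = inj₂ (is-π₁ (acts-cong h e))
    ... | κ , h , is-π₂ e _ = inj₂ (is-π₂ (acts-cong h e))
    ... | κ , h , is-π₃ e _ = inj₂ (is-π₃ (acts-cong h e))
    ... | κ , h , non-projection e = inj₁ (non-projection p h e)

    -- Useful operations on every pair from the Taylor identities.

    module Taylor
      (t-cong : ∀ {v w} → (∀ j → v j ≡ w j) → t v ≡ t w)
      (taylor : ∀ i → Σ (Fin k → ℕ) λ u → Σ (Fin k → ℕ) λ v →
                u i ≢ v i × (∀ (e : ℕ → A) → t (e ∘ u) ≡ t (e ∘ v)))
      {a b : A} (a≢b : a ≢ b) where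

      -- If t is a projection on {a, b}, then the large sets form a principal ultrafilter; the Taylor
      -- identities exclude this, as they yield for every i a large set that avoids i.
      Large : (Fin k → Bool) → Set
      Large S = t (at a b ∘ S) ≡ a

      sel : Bool → Bool → A → A → A → A → A
      sel true  true  x y z w = x
      sel true  false x y z w = y
      sel false true  x y z w = z
      sel false false x y z w = w

      -- `X` and `Y` cut the coordinates into four blocks, and `u` has one variable per block. Three
      -- identifications of variables give ternary operations; if none of them is useful, all are
      -- projections on the pair, and this forces the intersection to be large.
      large-∧ : ∀ {X Y} → Large X → Large Y → Useful a b ⊎ Large (λ j → X j ∧ Y j)
      large-∧ {X} {Y} lX lY = go (probe p₁ a b) (probe p₂ a b) (probe p₃ a b)
        where
        u : A → A → A → A → A
        u x y z w = t λ j → sel (X j) (Y j) x y z w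

        sel-pres : (R : A → A → Set) → ∀ c d {x x′ y y′ z z′ w w′} → R x x′ → R y y′ → R z z′ → R w w′ →
          R (sel c d x y z w) (sel c d x′ y′ z′ w′)
        sel-pres R true  true  x y z w = x
        sel-pres R true  false x y z w = y
        sel-pres R false true  x y z w = z
        sel-pres R false false x y z w = w

        p₁ : Pres₃ λ x y z → u x y z z
        p₁ {R} I x y z = closed I _ _ λ j → sel-pres R (X j) (Y j) x y z z
        p₂ : Pres₃ λ x y z → u x z y z
        p₂ {R} I x y z = closed I _ _ λ j → sel-pres R (X j) (Y j) x z y z
        p₃ : Pres₃ λ x y z → u z x y z
        p₃ {R} I x y z = closed I _ _ λ j → sel-pres R (X j) (Y j) z x y z

        uX : u a a b b ≡ a
        uX = trans (t-cong λ j → eq (X j) (Y j)) lX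
          where
          eq : ∀ c d → sel c d a a b b ≡ at a b c
          eq true  true  = refl
          eq true  false = refl
          eq false true  = refl
          eq false false = refl

        uY : u a b a b ≡ a
        uY = trans (t-cong λ j → eq (X j) (Y j)) lY
          where
          eq : ∀ c d → sel c d a b a b ≡ at a b d
          eq true  true  = refl
          eq true  false = refl
          eq false true  = refl
          eq false false = refl

        uX∧Y : u a b b b ≡ a → Large (λ j → X j ∧ Y j)
        uX∧Y = trans (t-cong λ j → sym (eq (X j) (Y j)))
          where
          eq : ∀ c d → sel c d a b b b ≡ at a b (c ∧ d)
          eq true  true  = refl
          eq true  false = refl
          eq false true  = refl
          eq false false = refl

        absurd : ∀ {c} {ℓ} {C : Set ℓ} → c ≡ a → c ≡ b → C
        absurd e e′ = ⊥-elim (a≢b (trans (sym e) e′))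

        go : Useful a b ⊎ Projection (λ x y z → u x y z z) a b →
             Useful a b ⊎ Projection (λ x y z → u x z y z) a b →
             Useful a b ⊎ Projection (λ x y z → u z x y z) a b →
             Useful a b ⊎ Large (λ j → X j ∧ Y j)
        go (inj₁ d) _ _ = inj₁ d
        go _ (inj₁ d) _ = inj₁ d
        go _ _ (inj₁ d) = inj₁ d
        go (inj₂ (is-π₁ h)) _ _ = inj₂ (uX∧Y (act h true false false))
        go _ (inj₂ (is-π₁ h)) _ = inj₂ (uX∧Y (act h true false false))
        -- A third projection would give `b` on `X` or on `Y`, which are large.
        go (inj₂ (is-π₃ h)) _ _ = absurd uX (act h true true false)
        go _ (inj₂ (is-π₃ h)) _ = absurd uY (act h true true false)
        -- Now `u b a b b` and `u b b a b` both equal `a`, as if two disjoint blocks were large; no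
        -- projection in the third place allows this.
        go (inj₂ (is-π₂ h₁)) (inj₂ (is-π₂ h₂)) (inj₂ (is-π₁ h₃)) =
          absurd (act h₂ false true false) (act h₃ false true false)
        go (inj₂ (is-π₂ h₁)) (inj₂ (is-π₂ h₂)) (inj₂ (is-π₂ h₃)) =
          absurd (act h₁ false true false) (act h₃ true false false)
        go (inj₂ (is-π₂ h₁)) (inj₂ (is-π₂ h₂)) (inj₂ (is-π₃ h₃)) =
          absurd (act h₁ false true false) (act h₃ true false false)

      -- With `a` for the variable `u i` and `b` for all others, the identity equates the values of
      -- `t` on `X₀` and `X₁`, of which only `X₀` contains `i`. Either `X₁` is large, or the
      -- complement of `X₀` is, or `m` commutes on the pair.
      large-avoiding : ∀ i → Useful a b ⊎ Σ (Fin k → Bool) λ X → Large X × X i ≡ false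
      large-avoiding i with taylor i
      ... | u , v , u≢v , t≡ = go (cons-at a b X₁) (cons₂ p b a)
        where
        X₀ X₁ : Fin k → Bool
        X₀ j = does (u j ≟ⁿ u i)
        X₁ j = does (v j ≟ⁿ u i)

        m : A → A → A
        m x y = t (at x y ∘ X₀)

        p : Pres₂ m
        p {R} I {x} {x′} {y} {y′} r s = closed I _ _ λ j → at-pres (X₀ j)
          where
          at-pres : ∀ c → R (at x y c) (at x′ y′ c)
          at-pres true  = r
          at-pres false = s

        eq : m a b ≡ t (at a b ∘ X₁)
        eq = t≡ λ c → at a b (does (c ≟ⁿ u i))

        flipped : ∀ c → at b a c ≡ at a b (not c)
        flipped true  = refl
        flipped false = refl

        go : t (at a b ∘ X₁) ≡ a ⊎ t (at a b ∘ X₁) ≡ b → m b a ≡ b ⊎ m b a ≡ a →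
             Useful a b ⊎ Σ (Fin k → Bool) λ X → Large X × X i ≡ false
        go (inj₁ e) _ = inj₂ (X₁ , e , dec-false (v i ≟ⁿ u i) (u≢v ∘ sym))
        go (inj₂ e) (inj₁ e′) = inj₁ (commutative p (trans eq (trans e (sym e′))))
        go (inj₂ e) (inj₂ e′) = inj₂ (not ∘ X₀ ,
          trans (t-cong λ j → sym (flipped (X₀ j))) e′ ,
          cong not (dec-true (u i ≟ⁿ u i) refl))

      -- The sets avoiding single coordinates are intersected, starting from the full set, which is
      -- large by idempotence.
      large-avoiding-all : (L : List (Fin k)) →
        Useful a b ⊎ Σ (Fin k → Bool) λ W → Large W × (∀ {i} → i ∈ L → W i ≡ false)
      large-avoiding-all [] = inj₂ ((λ _ → true) , all-a , λ ())
        where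
        all-a : t (λ _ → a) ≡ a
        all-a with closed (cons a a a) (λ _ → a) (λ _ → a) (λ _ → inj₁ refl)
        ... | inj₁ e = e
        ... | inj₂ (inj₁ e) = e
        ... | inj₂ (inj₂ e) = e
      large-avoiding-all (i ∷ L) with large-avoiding-all L | large-avoiding i
      ... | inj₁ d | _ = inj₁ d
      ... | inj₂ _ | inj₁ d = inj₁ d
      ... | inj₂ (W , lW , avoids) | inj₂ (X , lX , Xi) with large-∧ {W} {X} lW lX
      ... | inj₁ d = inj₁ d
      ... | inj₂ l = inj₂ (_ , l , avoids′)
        where
        ∧-false : ∀ c → c ∧ false ≡ false
        ∧-false true  = refl
        ∧-false false = refl
        avoids′ : ∀ {j} → j ∈ i ∷ L → W j ∧ X j ≡ false
        avoids′ (here refl) rewrite Xi = ∧-false (W i)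
        avoids′ (there j∈) rewrite avoids j∈ = refl

      -- Otherwise the empty set would be large, against idempotence at `b`.
      useful : Useful a b
      useful with large-avoiding-all (allFin k)
      ... | inj₁ d = d
      ... | inj₂ (W , lW , avoids) = ⊥-elim (a≢b (trans (sym lW) all-b))
        where
        all-b : t (at a b ∘ W) ≡ b
        all-b with closed (cons b b b) (at a b ∘ W) (at a b ∘ W) (λ j → inj₁ (cong (at a b) (avoids (∈-allFin j))))
        ... | inj₁ e = e
        ... | inj₂ (inj₁ e) = e
        ... | inj₂ (inj₂ e) = e

-- Colours of pairs.

record Minors {C : Set} (q : C → C → C → C) (a b c : C) : Set where
  field
    aab : q a a b ≡ c
    aba : q a b a ≡ c
    baa : q b a a ≡ c

-- Red pairs are those on which f is commutative; f is the first projection on the other pairs,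
-- where g is majority (yellow), or g is the first projection and h is minority (blue).
record Yellow {C : Set} (f : C → C → C) (g : C → C → C → C) (a b : C) : Set where
  field
    fixes : Fixes f a b
    majˡ  : Minors g a b a
    majʳ  : Minors g b a b

record Blue {C : Set} (f : C → C → C) (g h : C → C → C → C) (a b : C) : Set where
  field
    distinct : a ≢ b
    fixes    : Fixes f a b
    firstˡ   : g a b b ≡ a
    firstʳ   : g b a a ≡ b
    minˡ     : Minors h a b b
    minʳ     : Minors h b a a

record Colours {n k} (t : (Fin k → Fin n) → Fin n) : Set₁ where
  open Clone t
  field
    f : A → A → A
    g h : A → A → A → A
    f-pres : Pres₂ f
    g-pres : Pres₃ g
    h-pres : Pres₃ h
    colour : ∀ a b → Comm f a b ⊎ Yellow f g a b ⊎ Blue f g h a b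

-- Gluing the useful operations of all pairs into global ones.

module Colouring {n k : ℕ} (t : (Fin k → Fin n) → Fin n)
  (cons : ∀ x y z → Clone.Inv t (λ a _ → Clone.OneOf t x y z a))
  (useful : ∀ {a b} → a ≢ b → Clone.Conservative.Useful t cons a b) where

  open Clone t
  open Conservative cons

  π₁-id : π₁ ≗₃ (λ u _ _ → u)
  π₁-id = from-yes (π₁ ≗₃? (λ u _ _ → u))

  -- On a pair where `m` is the second projection this becomes the first one; where `m` commutes, so
  -- does the result.
  symmetrise : (A → A → A) → A → A → A
  symmetrise m x y = m (m x y) (m y x)

  symmetrise-comm⊎fixes : ∀ {m} → Pres₂ m → ∀ a b → Comm (symmetrise m) a b ⊎ Fixes (symmetrise m) a b
  symmetrise-comm⊎fixes {m} p a b with cons₂ p a b | cons₂ p b a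
  ... | inj₁ e | inj₁ e′ = inj₂ (trans (cong₂ m e e′) e , trans (cong₂ m e′ e) e′)
  ... | inj₁ e | inj₂ e′ = inj₁ (cong₂ m (trans e (sym e′)) (trans e′ (sym e)))
  ... | inj₂ e | inj₁ e′ = inj₁ (cong₂ m (trans e (sym e′)) (trans e′ (sym e)))
  ... | inj₂ e | inj₂ e′ = inj₂ (trans (cong₂ m e e′) e′ , trans (cong₂ m e′ e) e)

  record Selector : Set₁ where
    field
      f : A → A → A
      f-pres : Pres₂ f
      comm⊎fixes : ∀ a b → Comm f a b ⊎ Fixes f a b

  open Selector

  abstract

    -- Where `f` is the first projection, `fm` agrees with `m`; where `f` commutes, both arguments
    -- of `m` coincide and commutativity survives. Thus the commuting pairs of `f` and `m`
    -- accumulate.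
    absorb : (s : Selector) → ∀ {m} → Pres₂ m → Selector
    absorb s {m} p = record
      { f = symmetrise fm
      ; f-pres = λ I x y → fm-pres I (fm-pres I x y) (fm-pres I y x)
      ; comm⊎fixes = symmetrise-comm⊎fixes fm-pres
      }
      where
      fm : A → A → A
      fm x y = m (f s x y) (f s y x)
      fm-pres : Pres₂ fm
      fm-pres I x y = p I (f-pres s I x y) (f-pres s I y x)

    absorb-old : ∀ s {m} (p : Pres₂ m) {a b} → Comm (f s) a b → Comm (f (absorb s p)) a b
    absorb-old s {m} p {a} {b} c = cong₂ (λ x y → m (f s x y) (f s y x)) e (sym e)
      where
      e : m (f s a b) (f s b a) ≡ m (f s b a) (f s a b)
      e = cong₂ m c (sym c)

    absorb-new : ∀ s {m} (p : Pres₂ m) {a b} → Comm m a b → Comm (f (absorb s p)) a b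
    absorb-new s {m} p {a} {b} c with comm⊎fixes s a b
    ... | inj₁ d = absorb-old s p d
    ... | inj₂ (d , d′) = cong₂ (λ x y → m (f s x y) (f s y x)) e (sym e)
      where
      e : m (f s a b) (f s b a) ≡ m (f s b a) (f s a b)
      e = trans (cong₂ m d d′) (trans c (cong₂ m (sym d′) (sym d)))

  -- The invariant of the gluing: off the commuting pairs `q` behaves in one of three ways, and the
  -- first projection marks pairs that may still need treatment.
  record State : Set₁ where
    field
      selector : Selector
      q : A → A → A → A
      q-pres : Pres₃ q
      q-acts : ∀ a b → Comm (f selector) a b ⊎ ((Acts q a b maj ⊎ Acts q a b min) ⊎ Acts q a b π₁)

  open State

  Resolved : State → A → A → Set
  Resolved s a b = Comm (f (selector s)) a b ⊎ (Acts (q s) a b maj ⊎ Acts (q s) a b min)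

  initial : State
  initial = record
    { selector = record { f = λ x _ → x ; f-pres = λ _ x _ → x ; comm⊎fixes = λ _ _ → inj₂ (refl , refl) }
    ; q = λ x _ _ → x
    ; q-pres = λ _ x _ _ → x
    ; q-acts = λ a b → inj₂ (inj₂ (acts λ u v w → sym (cong (at a b) (π₁-id u v w))))
    }

  -- Once the three minors are absorbed, none of them commutes on a remaining pair. Hence
  -- `acts-pattern` applies there, and normalising restores the invariant.
  module Rebuild (s : Selector) {q₀ : A → A → A → A} (p : Pres₃ q₀) where

    s₁ s₂ s₃ : Selector
    s₁ = absorb s (minor₁-pres p)
    s₂ = absorb s₁ (minor₂-pres p)
    s₃ = absorb s₂ (minor₃-pres p)

    keep : ∀ {a b} → Comm (f s) a b → Comm (f s₃) a b
    keep = absorb-old s₂ (minor₃-pres p) ∘ absorb-old s₁ (minor₂-pres p) ∘ absorb-old s (minor₁-pres p)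

    pattern-of : ∀ a b → Comm (f s₃) a b ⊎ Σ BoolOp₃ λ κ → Acts q₀ a b κ × Class κ
    pattern-of a b with f s₃ a b ≟ f s₃ b a
    ... | yes c = inj₁ c
    ... | no ¬c = inj₂ (acts-pattern p
      (¬c ∘ absorb-old s₂ (minor₃-pres p) ∘ absorb-old s₁ (minor₂-pres p) ∘ absorb-new s (minor₁-pres p))
      (¬c ∘ absorb-old s₂ (minor₃-pres p) ∘ absorb-new s₁ (minor₂-pres p))
      (¬c ∘ absorb-new s₂ (minor₃-pres p)))

    state : State
    state = record
      { selector = s₃
      ; q = normal q₀
      ; q-pres = normal-pres p
      ; q-acts = λ a b → Sum.map₂ (λ (_ , h , c) → acts-normalised h (normalised c)) (pattern-of a b)
      }

  -- By cyclic symmetry the three arguments of `r` agree, and `r` is idempotent. So composing with a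
  -- new `r` does not disturb the pairs where `q` is majority or minority.
  rotate-cyclic : ∀ {r q : A → A → A → A} → Pres₃ r → ∀ {a b κ} → (∀ u v w → κ v w u ≡ κ u v w) →
    Acts q a b κ → Acts (rotate r q) a b κ
  rotate-cyclic {r} {q} p {a} {b} {κ} cyclic (acts h) = acts lemma
    where
    lemma : ∀ u v w → rotate r q (at a b u) (at a b v) (at a b w) ≡ at a b (κ u v w)
    lemma u v w rewrite h u v w | h v w u | h w u v | cyclic u v w | sym (cyclic w u v) = idem₃ p _

  maj-cyclic : ∀ u v w → maj v w u ≡ maj u v w
  maj-cyclic = from-yes ((λ u v w → maj v w u) ≗₃? maj)

  min-cyclic : ∀ u v w → min v w u ≡ min u v w
  min-cyclic = from-yes ((λ u v w → min v w u) ≗₃? min)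

  -- Here the rotated arguments of `r` are the original ones, so `r` takes over on a pair that was
  -- still a projection.
  rotate-π₁ : ∀ {r q : A → A → A → A} {a b κ} → Acts q a b π₁ → Acts r a b κ → Acts (rotate r q) a b κ
  rotate-π₁ {r} {q} {a} {b} {κ} (acts h) (acts h′) = acts lemma
    where
    lemma : ∀ u v w → rotate r q (at a b u) (at a b v) (at a b w) ≡ at a b (κ u v w)
    lemma u v w
      rewrite h u v w | h v w u | h w u v
            | π₁-id u v w | π₁-id v w u | π₁-id w u v = h′ u v w

  Extends : State → State → Set
  Extends s s′ = ∀ {a b} → Resolved s a b → Resolved s′ a b

  resolve : ∀ s a b → Σ State λ s′ → Extends s s′ × Resolved s′ a b
  resolve s a b with a ≟ b
  ... | yes refl = s , id , inj₁ refl
  ... | no a≢b with useful a≢b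
  ... | commutative {m} p c = s′ , extends , inj₁ (absorb-new (selector s) p c)
    where
    s′ : State
    s′ = record s
      { selector = absorb (selector s) p
      ; q-acts = λ x y → Sum.map (absorb-old (selector s) p) (id) (q-acts s x y)
      }
    extends : Extends s s′
    extends = Sum.map (absorb-old (selector s) p) (id)
  ... | non-projection {r} {κ} p h e = state , extends , resolved (q-acts s a b)
    where
    open Rebuild (selector s) {rotate r (q s)} (rotate-pres p (q-pres s))
    extends : Extends s state
    extends (inj₁ c) = inj₁ (keep c)
    extends (inj₂ (inj₁ h)) = inj₂ (inj₁
      (acts-cong (acts-normal (rotate-cyclic p maj-cyclic h)) normal-maj))
    extends (inj₂ (inj₂ h)) = inj₂ (inj₂
      (acts-cong (acts-normal (rotate-cyclic p min-cyclic h)) normal-min))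
    resolved : Comm (f (selector s)) a b ⊎ ((Acts (q s) a b maj ⊎ Acts (q s) a b min) ⊎ Acts (q s) a b π₁) →
      Resolved state a b
    resolved (inj₁ c) = inj₁ (keep c)
    resolved (inj₂ (inj₁ d)) = extends (inj₂ d)
    resolved (inj₂ (inj₂ g)) = inj₂ (Sum.map (acts-cong h″) (acts-cong h″) e)
      where
      h″ : Acts (normal (rotate r (q s))) a b (normal κ)
      h″ = acts-normal (rotate-π₁ g h)

  resolve-all : ∀ (L : List (A × A)) → Σ State λ s → ∀ {a b} → (a , b) ∈ L → Resolved s a b
  resolve-all [] = initial , λ ()
  resolve-all ((a , b) ∷ L) with resolve-all L
  ... | s , all with resolve s a b
  ... | s′ , extends , r = s′ , λ { (here refl) → r ; (there m) → extends (all m) }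

  resolved-state : Σ State λ s → ∀ a b → Resolved s a b
  resolved-state with resolve-all (cartesianProduct (allFin n) (allFin n))
  ... | s , all = s , λ a b → all (∈-cartesianProduct⁺ (∈-allFin a) (∈-allFin b))

  colours : Colours t
  colours with resolved-state
  ... | s , resolved = record
    { f = f (selector s) ; g = g ; h = q s
    ; f-pres = f-pres (selector s)
    ; g-pres = λ I x y z → q-pres s I y (q-pres s I y x z) z
    ; h-pres = q-pres s
    ; colour = colour
    }
    where
    g : A → A → A → A
    -- Modulo 2, y + (y + x + z) + z = x: minority becomes the first projection, while majority
    -- remains majority.
    g x y z = q s y (q s y x z) z

    g-acts : ∀ {a b : A} {κ} → Acts (q s) a b κ → Acts g a b (λ u v w → κ v (κ v u w) w)
    g-acts {a} {b} {κ} (acts h) = acts lemma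
      where
      lemma : ∀ u v w → g (at a b u) (at a b v) (at a b w) ≡ at a b (κ v (κ v u w) w)
      lemma u v w rewrite h v u w = h v (κ v u w) w

    colour : ∀ a b → Comm (f (selector s)) a b ⊎ Yellow (f (selector s)) g a b ⊎ Blue (f (selector s)) g (q s) a b
    colour a b with a ≟ b | comm⊎fixes (selector s) a b | resolved a b
    ... | yes refl | _ | _ = inj₁ refl
    ... | no _ | inj₁ c | _ = inj₁ c
    ... | no _ | inj₂ _ | inj₁ c = inj₁ c
    ... | no _ | inj₂ d | inj₂ (inj₁ h) = inj₂ (inj₁ record
      { fixes = d
      ; majˡ = record { aab = act h′ true true false ; aba = act h′ true false true ; baa = act h′ false true true }
      ; majʳ = record { aab = act h′ false false true ; aba = act h′ false true false ; baa = act h′ true false false }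
      })
      where
      h′ : Acts g a b (λ u v w → maj v (maj v u w) w)
      h′ = g-acts h
    ... | no a≢b | inj₂ d | inj₂ (inj₂ h) = inj₂ (inj₂ record
      { distinct = a≢b
      ; fixes = d
      ; firstˡ = act (g-acts h) true false false
      ; firstʳ = act (g-acts h) false true true
      ; minˡ = record { aab = act h true true false ; aba = act h true false true ; baa = act h false true true }
      ; minʳ = record { aab = act h false false true ; aba = act h false true false ; baa = act h true false false }
      })

-- Semilattice or majority behaviour, and triples as functions on `Fin 3`.

data SemilatticeOrMajority {C : Set} (M : C → C → C → C) (a b : C) : Set where
  semilattice : ∀ {m} → m ≡ a ⊎ m ≡ b → Minors M a b m → Minors M b a m → SemilatticeOrMajority M a b
  majority : Minors M a b a → Minors M b a b → SemilatticeOrMajority M a b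

third : (i j : Fin 3) → i ≢ j → Σ (Fin 3) λ k → k ≢ i × k ≢ j × (∀ l → l ≡ i ⊎ l ≡ j ⊎ l ≡ k)
third 0F 0F i≢j = ⊥-elim (i≢j refl)
third 0F 1F _ = 2F , (λ ()) , (λ ()) , λ { 0F → inj₁ refl ; 1F → inj₂ (inj₁ refl) ; 2F → inj₂ (inj₂ refl) }
third 0F 2F _ = 1F , (λ ()) , (λ ()) , λ { 0F → inj₁ refl ; 1F → inj₂ (inj₂ refl) ; 2F → inj₂ (inj₁ refl) }
third 1F 0F _ = 2F , (λ ()) , (λ ()) , λ { 0F → inj₂ (inj₁ refl) ; 1F → inj₁ refl ; 2F → inj₂ (inj₂ refl) }
third 1F 1F i≢j = ⊥-elim (i≢j refl)
third 1F 2F _ = 0F , (λ ()) , (λ ()) , λ { 0F → inj₂ (inj₂ refl) ; 1F → inj₁ refl ; 2F → inj₂ (inj₁ refl) }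
third 2F 0F _ = 1F , (λ ()) , (λ ()) , λ { 0F → inj₂ (inj₁ refl) ; 1F → inj₂ (inj₂ refl) ; 2F → inj₁ refl }
third 2F 1F _ = 0F , (λ ()) , (λ ()) , λ { 0F → inj₂ (inj₂ refl) ; 1F → inj₂ (inj₁ refl) ; 2F → inj₁ refl }
third 2F 2F i≢j = ⊥-elim (i≢j refl)

_[_≔_] : ∀ {m} {C : Set} → (Fin m → C) → Fin m → C → Fin m → C
(v [ i ≔ a ]) j with j ≟ i
... | yes _ = a
... | no _  = v j

≔-eq : ∀ {m} {C : Set} (v : Fin m → C) i a → (v [ i ≔ a ]) i ≡ a
≔-eq v i a with i ≟ i
... | yes _ = refl
... | no i≢i = ⊥-elim (i≢i refl)

≔-neq : ∀ {m} {C : Set} (v : Fin m → C) {i} a {j} → j ≢ i → (v [ i ≔ a ]) j ≡ v j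
≔-neq v {i} a {j} j≢i with j ≟ i
... | yes e = ⊥-elim (j≢i e)
... | no _ = refl

-- Majority on yellow and blue pairs.

module Majority {n k : ℕ} (t : (Fin k → Fin n) → Fin n)
  (cons : ∀ x y z → Clone.Inv t (λ a _ → Clone.OneOf t x y z a))
  (colours : Colours t) where

  open Clone t
  open Conservative cons
  open Colours colours

  Yel Blu : A → A → Set
  Yel = Yellow f g
  Blu = Blue f g h

  yel-sym : ∀ {a b} → Yel a b → Yel b a
  yel-sym y = record { fixes = proj₂ fixes , proj₁ fixes ; majˡ = majʳ ; majʳ = majˡ }
    where open Yellow y

  blu-sym : ∀ {a b} → Blu a b → Blu b a
  blu-sym b = record
    { distinct = distinct ∘ sym ; fixes = proj₂ fixes , proj₁ fixes
    ; firstˡ = firstʳ ; firstʳ = firstˡ ; minˡ = minʳ ; minʳ = minˡ }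
    where open Blue b

  -- The value `g a b b` would be `b` by yellow and `a` by blue.
  yel-blu : ∀ {a b} → Yel a b → Blu a b → ⊥
  yel-blu y b = Blue.distinct b (trans (sym (Blue.firstˡ b)) (Minors.baa (Yellow.majʳ y)))

  NonBlue Edge : A → A → Set
  NonBlue a b = a ≡ b ⊎ Yel a b
  Edge a b = a ≡ b ⊎ Yel a b ⊎ Blu a b

  g³ h³ : (Fin 3 → A) → A
  g³ x = g (x 0F) (x 1F) (x 2F)
  h³ x = h (x 0F) (x 1F) (x 2F)

  Diag : (A → A → Set) → (x x′ : Fin 3 → A) → Set
  Diag R x x′ = ∀ i → R (x i) (x′ i)

  g³-pres : ∀ {R} → Inv R → ∀ {x x′} → Diag R x x′ → R (g³ x) (g³ x′)
  g³-pres I d = g-pres I (d 0F) (d 1F) (d 2F)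

  h³-pres : ∀ {R} → Inv R → ∀ {x x′} → Diag R x x′ → R (h³ x) (h³ x′)
  h³-pres I d = h-pres I (d 0F) (d 1F) (d 2F)

  g³-maj : ∀ {a b} → Minors g a b a → ∀ (x : Fin 3 → A) m → x m ≡ b → (∀ j → j ≢ m → x j ≡ a) → g³ x ≡ a
  g³-maj y x 0F e es rewrite e | es 1F (λ ()) | es 2F (λ ()) = Minors.baa y
  g³-maj y x 1F e es rewrite e | es 0F (λ ()) | es 2F (λ ()) = Minors.aba y
  g³-maj y x 2F e es rewrite e | es 0F (λ ()) | es 1F (λ ()) = Minors.aab y

  h³-min : ∀ {a b} → Blu a b → ∀ (x : Fin 3 → A) m → x m ≡ b → (∀ j → j ≢ m → x j ≡ a) → h³ x ≡ b
  h³-min y x 0F e es rewrite e | es 1F (λ ()) | es 2F (λ ()) = Minors.baa (Blue.minˡ y)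
  h³-min y x 1F e es rewrite e | es 0F (λ ()) | es 2F (λ ()) = Minors.aba (Blue.minˡ y)
  h³-min y x 2F e es rewrite e | es 0F (λ ()) | es 1F (λ ()) = Minors.aab (Blue.minˡ y)

  YellowStar BlueStar : (Fin 3 → A) → Fin 3 → Set
  YellowStar x c = ∀ {j} → j ≢ c → Yel (x c) (x j)
  BlueStar   x e = ∀ {j} → j ≢ e → Blu (x e) (x j)

  -- If all edges are blue, then M has to avoid the entry that h selects.
  data Opposite (x : Fin 3 → A) (e : Fin 3) : Set where
    nonblue : (∀ {i j} → i ≢ e → j ≢ e → NonBlue (x i) (x j)) → Opposite x e
    blue    : (∀ {i j} → i ≢ j → Blu (x i) (x j)) → h³ x ≡ x e → Opposite x e

  flip-inv : ∀ {R} → Inv R → Inv (flip R)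
  flip-inv I = inv λ v v′ r → closed I v′ v r

  -- Invariant relations between yellow and blue pairs.

  module _ {R : A → A → Set} (I : Inv R) where

    -- Independence of the colours: applied to one related pair and twice the other, `g` keeps the
    -- first entry on the blue side and takes the repeated one on the yellow side.
    cross-bn : ∀ {a b c d} → Blu a b → NonBlue c d → R a c → R b d → R a d
    cross-bn _ (inj₁ refl) r _ = r
    cross-bn β (inj₂ y) r s =
      subst₂ R (Blue.firstˡ β) (Minors.baa (Yellow.majʳ y)) (g-pres I r s s)

    cross-nb : ∀ {a b c d} → NonBlue a b → Blu c d → R a c → R b d → R a d
    cross-nb (inj₁ refl) _ _ s = s
    cross-nb (inj₂ y) β r s =
      subst₂ R (Minors.baa (Yellow.majˡ y)) (Blue.firstʳ β) (g-pres I s r r)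

    -- Between two blue pairs an invariant relation is closed under minority, hence affine over the
    -- field with two elements: three corners of the square give the fourth.
    affine : ∀ {a b c d} → Blu a b → Blu c d → R a c → R a d → R b c → R b d
    affine β β′ r s u =
      subst₂ R (Minors.aab (Blue.minˡ β)) (Minors.aba (Blue.minˡ β′)) (h-pres I r s u)

    module _ {x x′ : Fin 3 → A} (d : Diag R x x′) where

      -- Every crossing uses a blue edge of `x` at `e` and a yellow edge of `x′` at `c`; the
      -- position of `c` decides the order in which the entries are reached.
      star-star : ∀ {e c} → BlueStar x e → YellowStar x′ c → ∀ {i} → i ≢ e → ∀ l → R (x i) (x′ l)
      star-star {e} {c} blu yel {i} i≢e l with third i e i≢e
      ... | k , k≢i , k≢e , cover = go (cover c) (cover l)
        where
        Blu-ie : Blu (x i) (x e)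
        Blu-ie = blu-sym (blu i≢e)
        go : c ≡ i ⊎ c ≡ e ⊎ c ≡ k → l ≡ i ⊎ l ≡ e ⊎ l ≡ k → R (x i) (x′ l)
        go _ (inj₁ refl) = d i
        go (inj₁ refl) (inj₂ (inj₁ refl)) = cross-bn Blu-ie (inj₂ (yel (i≢e ∘ sym))) (d i) (d e)
        go (inj₁ refl) (inj₂ (inj₂ refl)) = cross-bn Blu-ie (inj₂ (yel k≢i)) (d i) ek
          where
          ei : R (x e) (x′ i)
          ei = cross-bn (blu i≢e) (inj₂ (yel-sym (yel (i≢e ∘ sym)))) (d e) (d i)
          ek : R (x e) (x′ k)
          ek = cross-bn (blu k≢e) (inj₂ (yel k≢i)) ei (d k)
        go (inj₂ (inj₁ refl)) (inj₂ (inj₁ refl)) = cross-bn Blu-ie (inj₂ (yel-sym (yel i≢e))) (d i) (d e)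
        go (inj₂ (inj₁ refl)) (inj₂ (inj₂ refl)) = cross-bn Blu-ie (inj₂ (yel k≢e)) ie ek
          where
          ie : R (x i) (x′ e)
          ie = cross-bn Blu-ie (inj₂ (yel-sym (yel i≢e))) (d i) (d e)
          ek : R (x e) (x′ k)
          ek = cross-bn (blu k≢e) (inj₂ (yel k≢e)) (d e) (d k)
        go (inj₂ (inj₂ refl)) l∈ = helper l∈
          where
          ek : R (x e) (x′ k)
          ek = cross-bn (blu k≢e) (inj₂ (yel-sym (yel (k≢e ∘ sym)))) (d e) (d k)
          ik : R (x i) (x′ k)
          ik = cross-bn Blu-ie (inj₂ (yel-sym (yel (k≢i ∘ sym)))) (d i) ek
          helper : l ≡ i ⊎ l ≡ e ⊎ l ≡ k → R (x i) (x′ l)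
          helper (inj₁ refl) = d i
          helper (inj₂ (inj₁ refl)) = cross-bn Blu-ie (inj₂ (yel (k≢e ∘ sym))) ik (d e)
          helper (inj₂ (inj₂ refl)) = ik

      -- Together with the diagonal at `k`, this relates all entries of `x` off the centre `e` to
      -- all entries of `x′` off the centre `e′`, so any choice of values is compatible.
      record Full (e e′ k : Fin 3) : Set where
        field
          e′e : R (x e′) (x′ e)
          e′k : R (x e′) (x′ k)
          ke  : R (x k) (x′ e)

      module _ {e e′ k} (e≢e′ : e ≢ e′) (k≢e : k ≢ e) (k≢e′ : k ≢ e′)
               (cover : ∀ l → l ≡ e ⊎ l ≡ e′ ⊎ l ≡ k)
               (blu : BlueStar x e) (blu′ : BlueStar x′ e′) where

        private
          e′≢e : e′ ≢ e
          e′≢e = e≢e′ ∘ sym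

        full-nn : (∀ {i j} → i ≢ e → j ≢ e → NonBlue (x i) (x j)) →
                  (∀ {i j} → i ≢ e′ → j ≢ e′ → NonBlue (x′ i) (x′ j)) → Full e e′ k
        full-nn N N′ = record
          { e′e = cross-nb (N e′≢e k≢e) (blu′ e≢e′) (d e′) ke
          ; e′k = cross-nb (N e′≢e k≢e) (blu′ k≢e′) (d e′) (d k)
          ; ke  = ke }
          where
          ke : R (x k) (x′ e)
          ke = cross-bn (blu-sym (blu k≢e)) (N′ k≢e′ e≢e′) (d k) (d e)

        -- Crossing gives `e′k` and `ke′`. In `rows` the odd entry is `x e`, so `h` relates `x e` to
        -- `x′ e′`, and `affine` completes the squares.
        full-nb : (∀ {i j} → i ≢ e → j ≢ e → NonBlue (x i) (x j)) →
                  h³ x′ ≡ x′ e′ → Full e e′ k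
        full-nb N h≡ = record
          { e′e = affine (blu e′≢e) (blu′ e≢e′) ee′ (d e) (d e′)
          ; e′k = e′k
          ; ke  = affine (blu k≢e) (blu′ e≢e′) ee′ (d e) ke′ }
          where
          e′k : R (x e′) (x′ k)
          e′k = cross-nb (N e′≢e k≢e) (blu′ k≢e′) (d e′) (d k)
          ke′ : R (x k) (x′ e′)
          ke′ = cross-nb (N k≢e e′≢e) (blu-sym (blu′ k≢e′)) (d k) (d e′)
          rows : Fin 3 → A
          rows = (λ _ → x e′) [ e ≔ x e ]
          diag : Diag R rows x′
          diag l with cover l
          ... | inj₁ refl = subst (λ a → R a (x′ e)) (sym (≔-eq _ e _)) (d e)
          ... | inj₂ (inj₁ refl) = subst (λ a → R a (x′ e′)) (sym (≔-neq _ _ e′≢e)) (d e′)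
          ... | inj₂ (inj₂ refl) = subst (λ a → R a (x′ k)) (sym (≔-neq _ _ k≢e)) e′k
          ee′ : R (x e) (x′ e′)
          ee′ = subst₂ R (h³-min (blu-sym (blu e′≢e)) rows e (≔-eq _ e _) (λ j → ≔-neq _ _)) h≡
                (h³-pres I diag)

        -- Applying `h` to the diagonal relates the two centres. A centre can then be duplicated,
        -- which makes the entry at `k` the odd one that `h` returns; `affine` does the rest.
        full-bb : (∀ {i j} → i ≢ j → Blu (x i) (x j)) → h³ x ≡ x e →
                  (∀ {i j} → i ≢ j → Blu (x′ i) (x′ j)) → h³ x′ ≡ x′ e′ → Full e e′ k
        full-bb B h≡ B′ h′≡ = record
          { e′e = affine (B e≢e′) (B′ e′≢e) ee′ (d e) (d e′)
          ; e′k = affine (B k≢e′) (B′ (k≢e′ ∘ sym)) ke′ (d k) (d e′)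
          ; ke  = affine (B (k≢e ∘ sym)) (B′ k≢e) ek (d e) (d k) }
          where
          ee′ : R (x e) (x′ e′)
          ee′ = subst₂ R h≡ h′≡ (h³-pres I d)
          columns rows : Fin 3 → A
          columns = x′ [ e ≔ x′ e′ ]
          rows = x [ e′ ≔ x e ]
          columns-diag : Diag R x columns
          columns-diag l with l ≟ e
          ... | yes refl = ee′
          ... | no _ = d l
          rows-diag : Diag R rows x′
          rows-diag l with l ≟ e′
          ... | yes refl = ee′
          ... | no _ = d l
          columns-others : ∀ j → j ≢ k → columns j ≡ x′ e′
          columns-others j j≢k with cover j
          ... | inj₁ refl = ≔-eq _ e _
          ... | inj₂ (inj₁ refl) = ≔-neq _ _ e′≢e
          ... | inj₂ (inj₂ j≡k) = ⊥-elim (j≢k j≡k)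
          rows-others : ∀ j → j ≢ k → rows j ≡ x e
          rows-others j j≢k with cover j
          ... | inj₁ refl = ≔-neq _ _ e≢e′
          ... | inj₂ (inj₁ refl) = ≔-eq _ e′ _
          ... | inj₂ (inj₂ j≡k) = ⊥-elim (j≢k j≡k)
          ek : R (x e) (x′ k)
          ek = subst₂ R h≡ (h³-min (B′ (k≢e′ ∘ sym)) columns k (≔-neq _ _ k≢e) columns-others)
               (h³-pres I columns-diag)
          ke′ : R (x k) (x′ e′)
          ke′ = subst₂ R (h³-min (B (k≢e ∘ sym)) rows k (≔-neq _ _ k≢e′) rows-others) h′≡
                (h³-pres I rows-diag)

  full : ∀ {R} (I : Inv R) {x x′} (d : Diag R x x′) {e e′ k} → e ≢ e′ → k ≢ e → k ≢ e′ →
    (∀ l → l ≡ e ⊎ l ≡ e′ ⊎ l ≡ k) →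
    BlueStar x e → Opposite x e → BlueStar x′ e′ → Opposite x′ e′ → Full I d e e′ k
  full I d e≢ k≢ k≢′ cover blu (nonblue N) blu′ (nonblue N′) = full-nn I d e≢ k≢ k≢′ cover blu blu′ N N′
  full I d e≢ k≢ k≢′ cover blu (nonblue N) blu′ (blue _ h′≡) = full-nb I d e≢ k≢ k≢′ cover blu blu′ N h′≡
  full I d e≢ k≢ k≢′ cover blu (blue B h≡) blu′ (blue B′ h′≡) = full-bb I d e≢ k≢ k≢′ cover blu blu′ B h≡ B′ h′≡
  -- The converse relation, with `e` and `e′` exchanged, reduces this to `full-nb`.
  full I d {e} {e′} {k} e≢ k≢ k≢′ cover blu (blue _ h≡) blu′ (nonblue N′) =
    record { e′e = Full.e′e φ ; e′k = Full.ke φ ; ke = Full.e′k φ }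
    where
    swap : ∀ {l} → l ≡ e ⊎ l ≡ e′ ⊎ l ≡ k → l ≡ e′ ⊎ l ≡ e ⊎ l ≡ k
    swap (inj₁ p) = inj₂ (inj₁ p)
    swap (inj₂ (inj₁ p)) = inj₁ p
    swap (inj₂ (inj₂ p)) = inj₂ (inj₂ p)
    φ = full-nb (flip-inv I) d (e≢ ∘ sym) k≢′ k≢ (swap ∘ cover) blu′ blu N′ h≡

  -- The value on triples without red pairs.

  data Kind (x : Fin 3 → A) : Set where
    constant    : (∀ i j → x i ≡ x j) → Kind x
    yellow-star : ∀ c → YellowStar x c → Kind x
    blue-star   : ∀ e → BlueStar x e → Opposite x e → Kind x

  -- Any choice function with ι e ≢ e would do.
  ι : Fin 3 → Fin 3
  ι 0F = 1F
  ι (suc _) = 0F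

  ι-neq : ∀ e → ι e ≢ e
  ι-neq 0F ()
  ι-neq (suc _) ()

  -- Avoiding the centre of a blue star yields majority: if two entries of the star coincide, the
  -- centre is the odd one.
  value : ∀ {x} → Kind x → A
  value {x} (constant _)      = g³ x
  value {x} (yellow-star _ _) = g³ x
  value {x} (blue-star e _ _) = x (ι e)

  g³-constant : ∀ {x a} → (∀ i → x i ≡ a) → g³ x ≡ a
  g³-constant {x} {a} e rewrite e 0F | e 1F | e 2F = idem₃ g-pres a

  g³-value : ∀ x → Σ (Fin 3) λ l → g³ x ≡ x l
  g³-value x with cons₃ g-pres (x 0F) (x 1F) (x 2F)
  ... | inj₁ e = 0F , e
  ... | inj₂ (inj₁ e) = 1F , e
  ... | inj₂ (inj₂ e) = 2F , e

  blue-constant : ∀ {R} → Inv R → ∀ {x x′} → Diag R x x′ → ∀ e →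
    (∀ i j → x′ i ≡ x′ j) → R (x (ι e)) (g³ x′)
  blue-constant {R} I {x} d e c = subst (R (x (ι e))) (sym (g³-constant λ i → c i (ι e))) (d (ι e))

  -- By conservativity `g³ x′` is some entry of `x′`, and `star-star` covers them all.
  blue-yellow : ∀ {R} → Inv R → ∀ {x x′} → Diag R x x′ → ∀ {e c} →
    BlueStar x e → YellowStar x′ c → R (x (ι e)) (g³ x′)
  blue-yellow {R} I {x} {x′} d {e} blu yel with g³-value x′
  ... | l , eq = subst (R (x (ι e))) (sym eq) (star-star I d blu yel (ι-neq e) l)

  blue-blue : ∀ {R} → Inv R → ∀ {x x′} → Diag R x x′ → ∀ {e e′} →
    BlueStar x e → Opposite x e → BlueStar x′ e′ → Opposite x′ e′ → R (x (ι e)) (x′ (ι e′))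
  blue-blue {R} I {x} {x′} d {e} {e′} blu o blu′ o′ with e ≟ e′
  ... | yes refl = d (ι e)
  ... | no e≢e′ with third e e′ e≢e′
  ... | k , k≢e , k≢e′ , cover = go (cover (ι e)) (cover (ι e′))
    where
    open Full (full I d e≢e′ k≢e k≢e′ cover blu o blu′ o′)
    at-indices : ∀ {i j} → ι e ≡ i → ι e′ ≡ j → R (x i) (x′ j) → R (x (ι e)) (x′ (ι e′))
    at-indices p p′ = subst₂ (λ i j → R (x i) (x′ j)) (sym p) (sym p′)
    go : ι e ≡ e ⊎ ι e ≡ e′ ⊎ ι e ≡ k → ι e′ ≡ e ⊎ ι e′ ≡ e′ ⊎ ι e′ ≡ k → R (x (ι e)) (x′ (ι e′))
    go (inj₁ p) _ = ⊥-elim (ι-neq e p)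
    go _ (inj₂ (inj₁ p)) = ⊥-elim (ι-neq e′ p)
    go (inj₂ (inj₁ p)) (inj₁ p′) = at-indices p p′ e′e
    go (inj₂ (inj₁ p)) (inj₂ (inj₂ p′)) = at-indices p p′ e′k
    go (inj₂ (inj₂ p)) (inj₁ p′) = at-indices p p′ ke
    go (inj₂ (inj₂ p)) (inj₂ (inj₂ p′)) = at-indices p p′ (d k)

  value-pres : ∀ {R} → Inv R → ∀ {x x′} → Diag R x x′ → (K : Kind x) (K′ : Kind x′) → R (value K) (value K′)
  value-pres I d (constant _)        (constant _)           = g³-pres I d
  value-pres I d (constant _)        (yellow-star _ _)      = g³-pres I d
  value-pres I d (yellow-star _ _)   (constant _)           = g³-pres I d
  value-pres I d (yellow-star _ _)   (yellow-star _ _)      = g³-pres I d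
  value-pres I d (constant c)        (blue-star e _ _)      = blue-constant (flip-inv I) d e c
  value-pres I d (yellow-star _ yel) (blue-star _ blu _)    = blue-yellow (flip-inv I) d blu yel
  value-pres I d (blue-star e _ _)   (constant c)           = blue-constant I d e c
  value-pres I d (blue-star _ blu _) (yellow-star _ yel)    = blue-yellow I d blu yel
  value-pres I d (blue-star _ blu o) (blue-star _ blu′ o′)  = blue-blue I d blu o blu′ o′

  value-constant : ∀ {x a} → (∀ i → x i ≡ a) → (K : Kind x) → value K ≡ a
  value-constant c (constant _)      = g³-constant c
  value-constant c (yellow-star _ _) = g³-constant c
  value-constant c (blue-star e _ _) = c (ι e)

  -- Proved for every `Kind`, so that the one computed by `kind` need not be traced. A blue star
  -- must have its centre at `m`, since the centre differs from both other entries.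
  value-majority : ∀ {x a b} m → x m ≡ b → (∀ j → j ≢ m → x j ≡ a) → Yel a b ⊎ Blu a b →
    (K : Kind x) → value K ≡ a
  value-majority m p ps (inj₁ y) (constant _) = g³-maj (Yellow.majˡ y) _ m p ps
  value-majority m p ps (inj₁ y) (yellow-star _ _) = g³-maj (Yellow.majˡ y) _ m p ps
  value-majority {x} m p ps (inj₂ β) (constant c) =
    ⊥-elim (Blue.distinct β (trans (sym (ps (ι m) (ι-neq m))) (trans (c (ι m) m) p)))
  value-majority {x} m p ps (inj₂ β) (yellow-star c yel) with c ≟ m
  ... | yes refl = ⊥-elim (yel-blu (yel (ι-neq m)) (blu-sym (subst₂ Blu (sym (ps (ι m) (ι-neq m))) (sym p) β)))
  ... | no c≢m = ⊥-elim (yel-blu (yel (c≢m ∘ sym)) (subst₂ Blu (sym (ps c c≢m)) (sym p) β))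
  value-majority {x} m p ps _ (blue-star e blu _) with e ≟ m
  ... | yes refl = ps (ι e) (ι-neq e)
  ... | no e≢m with third e m e≢m
  ... | k , k≢e , k≢m , _ = ⊥-elim (Blue.distinct (blu k≢e) (trans (ps e e≢m) (sym (ps k k≢m))))

  kind : ∀ {x} → Edge (x 0F) (x 1F) → Edge (x 0F) (x 2F) → Edge (x 1F) (x 2F) → Kind x
  kind {x} = go
    where
    all-equal : (∀ i → x i ≡ x 0F) → Kind x
    all-equal e = constant λ i j → trans (e i) (sym (e j))
    yel₀ : Yel (x 0F) (x 1F) → Yel (x 0F) (x 2F) → Kind x
    yel₀ p q = yellow-star 0F λ { {0F} 0≢0 → ⊥-elim (0≢0 refl) ; {1F} _ → p ; {2F} _ → q }
    yel₁ : Yel (x 0F) (x 1F) → Yel (x 1F) (x 2F) → Kind x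
    yel₁ p q = yellow-star 1F λ { {0F} _ → yel-sym p ; {1F} 1≢1 → ⊥-elim (1≢1 refl) ; {2F} _ → q }
    yel₂ : Yel (x 0F) (x 2F) → Yel (x 1F) (x 2F) → Kind x
    yel₂ p q = yellow-star 2F λ { {0F} _ → yel-sym p ; {1F} _ → yel-sym q ; {2F} 2≢2 → ⊥-elim (2≢2 refl) }
    blu₀ : Blu (x 0F) (x 1F) → Blu (x 0F) (x 2F) → BlueStar x 0F
    blu₀ p q {0F} 0≢0 = ⊥-elim (0≢0 refl)
    blu₀ p q {1F} _ = p
    blu₀ p q {2F} _ = q
    blu₁ : Blu (x 0F) (x 1F) → Blu (x 1F) (x 2F) → BlueStar x 1F
    blu₁ p q {0F} _ = blu-sym p
    blu₁ p q {1F} 1≢1 = ⊥-elim (1≢1 refl)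
    blu₁ p q {2F} _ = q
    blu₂ : Blu (x 0F) (x 2F) → Blu (x 1F) (x 2F) → BlueStar x 2F
    blu₂ p q {0F} _ = blu-sym p
    blu₂ p q {1F} _ = blu-sym q
    blu₂ p q {2F} 2≢2 = ⊥-elim (2≢2 refl)
    nonblue-sym : ∀ {a b} → NonBlue a b → NonBlue b a
    nonblue-sym (inj₁ e) = inj₁ (sym e)
    nonblue-sym (inj₂ y) = inj₂ (yel-sym y)
    opposite : ∀ e {i j} → (∀ l → l ≡ i ⊎ l ≡ j ⊎ l ≡ e) → NonBlue (x i) (x j) → Opposite x e
    opposite e {i} {j} cover N = nonblue λ {l} {m} l≢e m≢e → cases (cover l) (cover m) l≢e m≢e
      where
      cases : ∀ {l m} → l ≡ i ⊎ l ≡ j ⊎ l ≡ e → m ≡ i ⊎ m ≡ j ⊎ m ≡ e → l ≢ e → m ≢ e → NonBlue (x l) (x m)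
      cases (inj₂ (inj₂ l≡e)) _ l≢e _ = ⊥-elim (l≢e l≡e)
      cases _ (inj₂ (inj₂ m≡e)) _ m≢e = ⊥-elim (m≢e m≡e)
      cases (inj₁ refl) (inj₁ refl) _ _ = inj₁ refl
      cases (inj₁ refl) (inj₂ (inj₁ refl)) _ _ = N
      cases (inj₂ (inj₁ refl)) (inj₁ refl) _ _ = nonblue-sym N
      cases (inj₂ (inj₁ refl)) (inj₂ (inj₁ refl)) _ _ = inj₁ refl
    cover-of : ∀ i j (i≢j : i ≢ j) → let e = proj₁ (third i j i≢j) in ∀ l → l ≡ i ⊎ l ≡ j ⊎ l ≡ e
    cover-of i j i≢j = proj₂ (proj₂ (proj₂ (third i j i≢j)))
    opp₀ : NonBlue (x 1F) (x 2F) → Opposite x 0F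
    opp₀ = opposite 0F (cover-of 1F 2F λ ())
    opp₁ : NonBlue (x 0F) (x 2F) → Opposite x 1F
    opp₁ = opposite 1F (cover-of 0F 2F λ ())
    opp₂ : NonBlue (x 0F) (x 1F) → Opposite x 2F
    opp₂ = opposite 2F (cover-of 0F 1F λ ())
    blues : Blu (x 0F) (x 1F) → Blu (x 0F) (x 2F) → Blu (x 1F) (x 2F) → ∀ {i j} → i ≢ j → Blu (x i) (x j)
    blues p q r {0F} i≢j = blu₀ p q (i≢j ∘ sym)
    blues p q r {1F} i≢j = blu₁ p r (i≢j ∘ sym)
    blues p q r {2F} i≢j = blu₂ q r (i≢j ∘ sym)
    all-blue : Blu (x 0F) (x 1F) → Blu (x 0F) (x 2F) → Blu (x 1F) (x 2F) → Kind x
    -- Every entry is the centre of a blue star; the one that `h` selects satisfies `Opposite`.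
    all-blue p q r with cons₃ h-pres (x 0F) (x 1F) (x 2F)
    ... | inj₁ e        = blue-star 0F (blu₀ p q) (blue (blues p q r) e)
    ... | inj₂ (inj₁ e) = blue-star 1F (blu₁ p r) (blue (blues p q r) e)
    ... | inj₂ (inj₂ e) = blue-star 2F (blu₂ q r) (blue (blues p q r) e)
    clash : ∀ {a b} → Yel a b → Blu a b → Kind x
    clash y β = ⊥-elim (yel-blu y β)
    go : Edge (x 0F) (x 1F) → Edge (x 0F) (x 2F) → Edge (x 1F) (x 2F) → Kind x
    go (inj₁ p) (inj₁ q) _ = all-equal λ { 0F → refl ; 1F → sym p ; 2F → sym q }
    go (inj₁ p) _ (inj₁ r) = all-equal λ { 0F → refl ; 1F → sym p ; 2F → sym (trans p r) }
    go _ (inj₁ q) (inj₁ r) = all-equal λ { 0F → refl ; 1F → trans r (sym q) ; 2F → sym q }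
    go (inj₂ (inj₁ p)) (inj₂ (inj₁ q)) _ = yel₀ p q
    go (inj₂ (inj₁ p)) _ (inj₂ (inj₁ r)) = yel₁ p r
    go _ (inj₂ (inj₁ q)) (inj₂ (inj₁ r)) = yel₂ q r
    go (inj₂ (inj₂ p)) (inj₂ (inj₂ q)) (inj₂ (inj₂ r)) = all-blue p q r
    go (inj₂ (inj₂ p)) (inj₂ (inj₂ q)) (inj₁ r)        = blue-star 0F (blu₀ p q) (opp₀ (inj₁ r))
    go (inj₂ (inj₂ p)) (inj₂ (inj₂ q)) (inj₂ (inj₁ r)) = blue-star 0F (blu₀ p q) (opp₀ (inj₂ r))
    go (inj₂ (inj₂ p)) (inj₁ q)        (inj₂ (inj₂ r)) = blue-star 1F (blu₁ p r) (opp₁ (inj₁ q))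
    go (inj₂ (inj₂ p)) (inj₂ (inj₁ q)) (inj₂ (inj₂ r)) = blue-star 1F (blu₁ p r) (opp₁ (inj₂ q))
    go (inj₁ p)        (inj₂ (inj₂ q)) (inj₂ (inj₂ r)) = blue-star 2F (blu₂ q r) (opp₂ (inj₁ p))
    go (inj₂ (inj₁ p)) (inj₂ (inj₂ q)) (inj₂ (inj₂ r)) = blue-star 2F (blu₂ q r) (opp₂ (inj₂ p))
    -- Equal entries are joined to the third by edges of the same colour, so one yellow and one blue
    -- edge are impossible here.
    go (inj₁ p) (inj₂ (inj₁ q)) (inj₂ (inj₂ r)) = clash (subst (λ a → Yel a (x 2F)) p q) r
    go (inj₁ p) (inj₂ (inj₂ q)) (inj₂ (inj₁ r)) = clash r (subst (λ a → Blu a (x 2F)) p q)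
    go (inj₂ (inj₁ p)) (inj₁ q) (inj₂ (inj₂ r)) = clash (subst (λ a → Yel a (x 1F)) q p) (blu-sym r)
    go (inj₂ (inj₂ p)) (inj₁ q) (inj₂ (inj₁ r)) = clash (yel-sym r) (subst (λ a → Blu a (x 1F)) q p)
    go (inj₂ (inj₁ p)) (inj₂ (inj₂ q)) (inj₁ r) = clash (subst (Yel _) r p) q
    go (inj₂ (inj₂ p)) (inj₂ (inj₁ q)) (inj₁ r) = clash q (subst (Blu _) r p)

  -- Removing red pairs, and the operation `M`.

  record Red (x y : A) : Set where
    field
      meet    : A
      xy      : f x y ≡ meet
      yx      : f y x ≡ meet
      meet-of : meet ≡ x ⊎ meet ≡ y

  idem : ∀ x → f x x ≡ x
  idem = idem₂ f-pres

  red : ∀ {x y} → Comm f x y → Red x y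
  red {x} {y} c = record { meet = f x y ; xy = refl ; yx = sym c ; meet-of = cons₂ f-pres x y }

  red-sym : ∀ {x y} → Red x y → Red y x
  red-sym r = record { meet = meet ; xy = yx ; yx = xy ; meet-of = Sum.swap meet-of }
    where open Red r

  module _ {x y} (r : Red x y) where
    open Red r

    red-absorb : f x meet ≡ meet × f meet x ≡ meet
    red-absorb with meet-of
    ... | inj₁ refl = idem _ , idem _
    ... | inj₂ refl = xy , yx

  red⊎edge : ∀ x y → Red x y ⊎ Edge x y
  red⊎edge x y with colour x y
  ... | inj₁ c = inj₁ (red c)
  ... | inj₂ e = inj₂ (inj₂ e)

  edge-sym : ∀ {x y} → Edge x y → Edge y x
  edge-sym (inj₁ e) = inj₁ (sym e)
  edge-sym (inj₂ (inj₁ y)) = inj₂ (inj₁ (yel-sym y))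
  edge-sym (inj₂ (inj₂ β)) = inj₂ (inj₂ (blu-sym β))

  edge-fixes : ∀ {x y} → Edge x y → f x y ≡ x × f y x ≡ y
  edge-fixes (inj₁ refl) = idem _ , idem _
  edge-fixes (inj₂ (inj₁ y)) = Yellow.fixes y
  edge-fixes (inj₂ (inj₂ β)) = Blue.fixes β

  A³ : Set
  A³ = A × A × A

  merge₀₁ merge₀₂ merge₁₂ merge merge² : A³ → A³
  merge₀₁ (x , y , z) = f x y , f y x , z
  merge₀₂ (x , y , z) = f x z , y , f z x
  merge₁₂ (x , y , z) = x , f y z , f z y
  merge  = merge₁₂ ∘ merge₀₂ ∘ merge₀₁
  merge² = merge ∘ merge

  step₀₁ : ∀ {x y z a b} → f x y ≡ a × f y x ≡ b → merge₀₁ (x , y , z) ≡ (a , b , z)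
  step₀₁ (refl , refl) = refl

  step₀₂ : ∀ {x y z a b} → f x z ≡ a × f z x ≡ b → merge₀₂ (x , y , z) ≡ (a , y , b)
  step₀₂ (refl , refl) = refl

  step₁₂ : ∀ {x y z a b} → f y z ≡ a × f z y ≡ b → merge₁₂ (x , y , z) ≡ (x , a , b)
  step₁₂ (refl , refl) = refl

  run : ∀ {τ τ₁ τ₂ τ₃} → merge₀₁ τ ≡ τ₁ → merge₀₂ τ₁ ≡ τ₂ → merge₁₂ τ₂ ≡ τ₃ → merge τ ≡ τ₃
  run refl refl refl = refl

  run² : ∀ {τ τ₁ τ₂} → merge τ ≡ τ₁ → merge τ₁ ≡ τ₂ → merge² τ ≡ τ₂
  run² refl refl = refl

  Edges : A³ → Set
  Edges (x , y , z) = Edge x y × Edge x z × Edge y z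

  idem-fixes : ∀ {x} → f x x ≡ x × f x x ≡ x
  idem-fixes = idem _ , idem _

  merge-edges : ∀ {τ} → Edges τ → merge τ ≡ τ
  merge-edges (p , q , r) = run (step₀₁ (edge-fixes p)) (step₀₂ (edge-fixes q)) (step₁₂ (edge-fixes r))

  constant-edges : ∀ {x} → Edges (x , x , x)
  constant-edges = inj₁ refl , inj₁ refl , inj₁ refl

  -- Merging a red pair leaves at most two values, but these may form a red pair again: hence two rounds.
  settle : ∀ τ → Σ A³ λ σ → merge² τ ≡ σ × Edges σ
  settle (x , y , z) with red⊎edge x y
  ... | inj₁ r with red⊎edge (Red.meet r) z
  ... | inj₂ e = _ , run² (run (step₀₁ (Red.xy r , Red.yx r)) (step₀₂ (edge-fixes e)) (step₁₂ (edge-fixes e)))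
                          (merge-edges edges) , edges
    where edges = inj₁ refl , e , e
  ... | inj₁ s = _ , run² (run (step₀₁ (Red.xy r , Red.yx r)) (step₀₂ (Red.xy s , Red.yx s)) (step₁₂ (red-absorb s)))
                          (merge-edges constant-edges) , constant-edges
  settle (x , y , z) | inj₂ p with red⊎edge x z
  ... | inj₁ r with red⊎edge y (Red.meet r)
  ... | inj₂ e = _ , run² (run (step₀₁ (edge-fixes p)) (step₀₂ (Red.xy r , Red.yx r)) (step₁₂ (edge-fixes e)))
                          (merge-edges edges) , edges
    where edges = edge-sym e , inj₁ refl , e
  ... | inj₁ s = _ , run² (run (step₀₁ (edge-fixes p)) (step₀₂ (Red.xy r , Red.yx r)) (step₁₂ (Red.xy s , Red.yx s)))
                          (run (step₀₁ (red-absorb (red-sym s))) (step₀₂ idem-fixes) (step₁₂ idem-fixes)) , constant-edges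
  settle (x , y , z) | inj₂ p | inj₂ q with red⊎edge y z
  ... | inj₂ e = _ , run² (merge-edges edges)
                          (merge-edges edges) , edges
    where edges = p , q , e
  ... | inj₁ r with red⊎edge x (Red.meet r)
  ... | inj₂ e = _ , run² (run (step₀₁ (edge-fixes p)) (step₀₂ (edge-fixes q)) (step₁₂ (Red.xy r , Red.yx r)))
                          (merge-edges edges) , edges
    where edges = e , e , inj₁ refl
  ... | inj₁ s = _ , run² (run (step₀₁ (edge-fixes p)) (step₀₂ (edge-fixes q)) (step₁₂ (Red.xy r , Red.yx r)))
                          (run (step₀₁ (Red.xy s , Red.yx s)) (step₀₂ (Product.swap (red-absorb (red-sym s)))) (step₁₂ idem-fixes)) , constant-edges

  Rel³ : (A → A → Set) → A³ → A³ → Set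
  Rel³ R (x , y , z) (x′ , y′ , z′) = R x x′ × R y y′ × R z z′

  merge-pres : ∀ {R} → Inv R → ∀ {τ τ′} → Rel³ R τ τ′ → Rel³ R (merge τ) (merge τ′)
  merge-pres {R} I = pres₁₂ ∘ pres₀₂ ∘ pres₀₁
    where
    pres₀₁ : ∀ {τ τ′} → Rel³ R τ τ′ → Rel³ R (merge₀₁ τ) (merge₀₁ τ′)
    pres₀₁ (x , y , z) = f-pres I x y , f-pres I y x , z
    pres₀₂ : ∀ {τ τ′} → Rel³ R τ τ′ → Rel³ R (merge₀₂ τ) (merge₀₂ τ′)
    pres₀₂ (x , y , z) = f-pres I x z , y , f-pres I z x
    pres₁₂ : ∀ {τ τ′} → Rel³ R τ τ′ → Rel³ R (merge₁₂ τ) (merge₁₂ τ′)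
    pres₁₂ (x , y , z) = x , f-pres I y z , f-pres I z y

  entries : A³ → Fin 3 → A
  entries (x , y , z) 0F = x
  entries (x , y , z) 1F = y
  entries (x , y , z) 2F = z

  kind-of : ∀ {σ} → Edges σ → Kind (entries σ)
  kind-of (p , q , r) = kind p q r

  M³ : A³ → A
  M³ τ = value (kind-of (proj₂ (proj₂ (settle τ))))

  M : A → A → A → A
  M x y z = M³ (x , y , z)

  -- All triples are settled by the same composite `merge²`, so related triples stay related, and
  -- `value-pres` compares the outcomes whatever their kinds.
  M-pres : Pres₃ M
  M-pres {R} I {a} {a′} {b} {b′} {c} {c′} r s u =
    value-pres I (diag _ _ merged) (kind-of (proj₂ (proj₂ S))) (kind-of (proj₂ (proj₂ S′)))
    where
    S = settle (a , b , c)
    S′ = settle (a′ , b′ , c′)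
    merged : Rel³ R (proj₁ S) (proj₁ S′)
    merged = subst₂ (Rel³ R) (proj₁ (proj₂ S)) (proj₁ (proj₂ S′)) (merge-pres I (merge-pres I (r , s , u)))
    diag : ∀ σ σ′ → Rel³ R σ σ′ → Diag R (entries σ) (entries σ′)
    diag _ _ (r , s , u) 0F = r
    diag _ _ (r , s , u) 1F = s
    diag _ _ (r , s , u) 2F = u

  M³-value : ∀ {τ σ} → merge² τ ≡ σ → Σ (Kind (entries σ)) λ K → M³ τ ≡ value K
  M³-value {τ} refl with settle τ
  ... | _ , refl , edges = kind-of edges , refl

  -- One round of merging already makes the triple constant.
  M-red : ∀ {a b} (r : Red a b) → Minors M a b (Red.meet r)
  M-red {a} {b} r = record
    { aab = to-meet (run² (run (step₀₁ idem-fixes) (step₀₂ (xy , yx)) (step₁₂ (red-absorb r))) fixed)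
    ; aba = to-meet (run² (run (step₀₁ (xy , yx)) (step₀₂ (Product.swap (red-absorb r))) (step₁₂ idem-fixes)) fixed)
    ; baa = to-meet (run² (run (step₀₁ (yx , xy)) (step₀₂ (Product.swap (red-absorb r))) (step₁₂ idem-fixes)) fixed)
    }
    where
    open Red r
    fixed : merge (meet , meet , meet) ≡ (meet , meet , meet)
    fixed = merge-edges constant-edges
    to-meet : ∀ {τ} → merge² τ ≡ (meet , meet , meet) → M³ τ ≡ meet
    to-meet e with M³-value e
    ... | K , eq = trans eq (value-constant (λ { 0F → refl ; 1F → refl ; 2F → refl }) K)

  M-majority : ∀ {a b} → Yel a b ⊎ Blu a b → Minors M a b a
  M-majority {a} {b} y = record
    { aab = to-major 2F refl (λ { 0F _ → refl ; 1F _ → refl ; 2F 2≢2 → ⊥-elim (2≢2 refl) }) (inj₁ refl , e , e)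
    ; aba = to-major 1F refl (λ { 0F _ → refl ; 1F 1≢1 → ⊥-elim (1≢1 refl) ; 2F _ → refl }) (e , inj₁ refl , edge-sym e)
    ; baa = to-major 0F refl (λ { 0F 0≢0 → ⊥-elim (0≢0 refl) ; 1F _ → refl ; 2F _ → refl }) (edge-sym e , edge-sym e , inj₁ refl)
    }
    where
    e : Edge a b
    e = inj₂ y
    to-major : ∀ {τ} m → entries τ m ≡ b → (∀ j → j ≢ m → entries τ j ≡ a) → Edges τ → M³ τ ≡ a
    to-major m p ps edges with M³-value (run² (merge-edges edges) (merge-edges edges))
    ... | K , eq = trans eq (value-majority m p ps y K)

  M-colour : ∀ a b → SemilatticeOrMajority M a b
  M-colour a b with colour a b
  ... | inj₁ c = semilattice (Red.meet-of (red c)) (M-red (red c)) (M-red (red-sym (red c)))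
  ... | inj₂ (inj₁ y) = majority (M-majority (inj₁ y)) (M-majority (inj₁ (yel-sym y)))
  ... | inj₂ (inj₂ β) = majority (M-majority (inj₂ β)) (M-majority (inj₂ (blu-sym β)))

-- Two-variable identities of `M`.

module Identities {A : Set} {M : A → A → A → A} (colour : ∀ a b → SemilatticeOrMajority M a b) where

  -- The semilattice operation on semilattice pairs and the first projection on majority pairs; each
  -- identity below is checked in these two cases.
  F : A → A → A
  F x y = M x x y

  F-idem : ∀ x → F x x ≡ x
  F-idem x with colour x x
  ... | semilattice (inj₁ e) s _ = trans (Minors.aab s) e
  ... | semilattice (inj₂ e) s _ = trans (Minors.aab s) e
  ... | majority s _ = Minors.aab s

  module _ (x y : A) where

    F-absorbˡ : F x (F x y) ≡ F x y
    F-absorbˡ with colour x y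
    ... | semilattice (inj₁ refl) s _ rewrite Minors.aab s = F-idem x
    ... | semilattice (inj₂ refl) s _ rewrite Minors.aab s = Minors.aab s
    ... | majority s _ rewrite Minors.aab s = F-idem x

    F-absorbʳ : F (F x y) y ≡ F x y
    F-absorbʳ with colour x y
    ... | semilattice (inj₁ refl) s _ rewrite Minors.aab s = Minors.aab s
    ... | semilattice (inj₂ refl) s _ rewrite Minors.aab s = F-idem y
    ... | majority s _ rewrite Minors.aab s = Minors.aab s

    F-absorb : F (F x y) x ≡ F x y
    F-absorb with colour x y
    ... | semilattice (inj₁ refl) s _ rewrite Minors.aab s = F-idem x
    ... | semilattice (inj₂ refl) s s′ rewrite Minors.aab s = Minors.aab s′
    ... | majority s _ rewrite Minors.aab s = F-idem x

    M-left : M (F x y) (F y x) x ≡ F x y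
    M-left with colour x y
    ... | semilattice (inj₁ refl) s s′ rewrite Minors.aab s | Minors.aab s′ = F-idem x
    ... | semilattice (inj₂ refl) s s′ rewrite Minors.aab s | Minors.aab s′ = Minors.aab s′
    ... | majority s s′ rewrite Minors.aab s | Minors.aab s′ = Minors.aba s

    M-right : M (F x y) (F y x) y ≡ F y x
    M-right with colour x y
    ... | semilattice (inj₁ refl) s s′ rewrite Minors.aab s | Minors.aab s′ = Minors.aab s
    ... | semilattice (inj₂ refl) s s′ rewrite Minors.aab s | Minors.aab s′ = F-idem y
    ... | majority s s′ rewrite Minors.aab s | Minors.aab s′ = Minors.baa s′

-- From the relational structure to the clone.

∣⁅x⁆∪p∣≤1+∣p∣ : ∀ {n} (x : Fin n) (p : Subset n) → ∣ ⁅ x ⁆ ∪ p ∣ ≤ suc ∣ p ∣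
∣⁅x⁆∪p∣≤1+∣p∣ zero (true ∷ p) rewrite ∪-identityˡ p = m≤n⇒m≤1+n ≤-refl
∣⁅x⁆∪p∣≤1+∣p∣ zero (false ∷ p) rewrite ∪-identityˡ p = ≤-refl
∣⁅x⁆∪p∣≤1+∣p∣ (suc x) (true ∷ p) = s≤s (∣⁅x⁆∪p∣≤1+∣p∣ x p)
∣⁅x⁆∪p∣≤1+∣p∣ (suc x) (false ∷ p) = ∣⁅x⁆∪p∣≤1+∣p∣ x p

1≤m≤3 : ∀ {m} → 1 ≤ m → m ≤ 3 → m ≡ 1 ⊎ m ≡ 2 ⊎ m ≡ 3
1≤m≤3 {1} _ _ = inj₁ refl
1≤m≤3 {2} _ _ = inj₂ (inj₁ refl)
1≤m≤3 {3} _ _ = inj₂ (inj₂ refl)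
1≤m≤3 {suc (suc (suc (suc _)))} _ (s≤s (s≤s (s≤s ())))

module _ {n : ℕ} where

  triple-set : Fin n → Fin n → Fin n → Subset n
  triple-set x y z = ⁅ x ⁆ ∪ (⁅ y ⁆ ∪ ⁅ z ⁆)

  triple-set-size : ∀ x y z → let S = triple-set x y z in ∣ S ∣ ≡ 1 ⊎ ∣ S ∣ ≡ 2 ⊎ ∣ S ∣ ≡ 3
  triple-set-size x y z = 1≤m≤3
    (≤-trans (≤-reflexive (sym (∣⁅x⁆∣≡1 x))) (∣p∣≤∣p∪q∣ ⁅ x ⁆ _))
    (≤-trans (∣⁅x⁆∪p∣≤1+∣p∣ x _) (s≤s (≤-trans (∣⁅x⁆∪p∣≤1+∣p∣ y _) (s≤s (≤-reflexive (∣⁅x⁆∣≡1 z))))))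

  triple-set⁻ : ∀ {x y z a} → a ∈ˢ triple-set x y z → a ≡ x ⊎ a ≡ y ⊎ a ≡ z
  triple-set⁻ {x} {y} {z} a∈ with x∈p∪q⁻ ⁅ x ⁆ _ a∈
  ... | inj₁ a∈x = inj₁ (x∈⁅y⁆⇒x≡y x a∈x)
  ... | inj₂ a∈yz with x∈p∪q⁻ ⁅ y ⁆ _ a∈yz
  ... | inj₁ a∈y = inj₂ (inj₁ (x∈⁅y⁆⇒x≡y y a∈y))
  ... | inj₂ a∈z = inj₂ (inj₂ (x∈⁅y⁆⇒x≡y z a∈z))

  triple-set⁺ : ∀ {x y z a} → a ≡ x ⊎ a ≡ y ⊎ a ≡ z → a ∈ˢ triple-set x y z
  triple-set⁺ (inj₁ refl)        = x∈p∪q⁺ (inj₁ (x∈⁅x⁆ _))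
  triple-set⁺ (inj₂ (inj₁ refl)) = x∈p∪q⁺ (inj₂ (x∈p∪q⁺ (inj₁ (x∈⁅x⁆ _))))
  triple-set⁺ (inj₂ (inj₂ refl)) = x∈p∪q⁺ (inj₂ (x∈p∪q⁺ (inj₂ (x∈⁅x⁆ _))))

  on-functions : ∀ {k} → (Vec (Fin n) k → Fin n) → (Fin k → Fin n) → Fin n
  on-functions f v = f (tabulate v)

  on-vectors : (Fin n → Fin n → Fin n → Fin n) → Vec (Fin n) 3 → Fin n
  on-vectors M (x ∷ y ∷ z ∷ []) = M x y z

  module _ {k} (f : Vec (Fin n) k → Fin n) where

    preserves-tuples : ∀ {m R} → Preserves {m = m} f R → (v : Fin k → Vec (Fin n) m) → (∀ j → R (v j)) →
      R (tabulate λ c → on-functions f λ j → lookup (v j) c)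
    preserves-tuples {R = R} P v r = subst R
      (tabulate-cong λ c → cong f (sym (tabulate-∘ (λ w → lookup w c) v)))
      (P (tabulate v) λ j → subst R (sym (lookup∘tabulate v j)) (r j))

    preserves-set : ∀ {m R} → Preserves {m = m} f R → m ≡ 1 → ∀ {S : Subset n} →
      (∀ v → (R v → ∀ c → lookup v c ∈ˢ S) × ((∀ c → lookup v c ∈ˢ S) → R v)) →
      ∀ v → (∀ j → v j ∈ˢ S) → on-functions f v ∈ˢ S
    preserves-set {R = R} P refl R⇔S v v∈S =
      proj₁ (R⇔S (on-functions f v ∷ [])) (preserves-tuples {R = R} P (λ j → v j ∷ [])
        λ j → proj₂ (R⇔S (v j ∷ [])) λ { zero → v∈S j }) zero

    -- This is the only place where it matters that the relations are unary or binary.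
    preserves-ternary : ∀ {M} → Clone.Pres₃ (on-functions f) M →
      ∀ {m R} → Preserves {m = m} f R → m ≡ 1 ⊎ m ≡ 2 → Preserves (on-vectors M) R
    preserves-ternary M-pres {R = R} P (inj₁ refl) ((a ∷ []) ∷ (b ∷ []) ∷ (c ∷ []) ∷ []) r =
      M-pres {λ a _ → R (a ∷ [])}
        (Clone.inv λ v _ → preserves-tuples {R = R} P λ j → v j ∷ [])
        {a} {a} {b} {b} {c} {c} (r 0F) (r 1F) (r 2F)
    preserves-ternary M-pres {R = R} P (inj₂ refl) ((_ ∷ _ ∷ []) ∷ (_ ∷ _ ∷ []) ∷ (_ ∷ _ ∷ []) ∷ []) r =
      M-pres {λ a b → R (a ∷ b ∷ [])}
        (Clone.inv λ v v′ → preserves-tuples {R = R} P λ j → v j ∷ v′ j ∷ [])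
        (r 0F) (r 1F) (r 2F)

  module _ (𝔸 : RelStr n) (3-cons : ThreeConservative 𝔸) (unary⊎binary : UnaryOrBinary 𝔸)
           (p : Pol 𝔸) (taylor : IsTaylor p) where

    private
      t : (Fin (arity p) → Fin n) → Fin n
      t = on-functions (op p)

    open Clone t

    conservative : ∀ x y z → Inv (λ a _ → OneOf x y z a)
    conservative x y z with 3-cons (triple-set x y z) (triple-set-size x y z)
    ... | i , ar≡1 , R⇔S = inv λ v _ v∈ →
      triple-set⁻ (preserves-set (op p) {R = rel 𝔸 i} (preserves p i) ar≡1 R⇔S v (λ j → triple-set⁺ (v∈ j)))

    -- Tabulating replaces extensionality: pointwise equal functions give the same vector.
    t-cong : ∀ {v w} → (∀ j → v j ≡ w j) → t v ≡ t w
    t-cong e = cong (op p) (tabulate-cong e)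

    taylor-functions : ∀ i → Σ (Fin (arity p) → ℕ) λ u → Σ (Fin (arity p) → ℕ) λ v →
      u i ≢ v i × (∀ (e : ℕ → Fin n) → t (e ∘ u) ≡ t (e ∘ v))
    taylor-functions i with taylor i
    ... | u , v , u≢v , t≡ = lookup u , lookup v , u≢v , λ e →
      trans (cong (op p) (as-map e u)) (trans (t≡ e) (cong (op p) (sym (as-map e v))))
      where
      as-map : ∀ (e : ℕ → Fin n) u → tabulate (e ∘ lookup u) ≡ map e u
      as-map e u = trans (tabulate-∘ e (lookup u)) (cong (map e) (tabulate∘lookup u))

    semilattice-majority : Σ (Fin n → Fin n → Fin n → Fin n) λ M →
      (∀ i → Preserves (on-vectors M) (rel 𝔸 i)) × (∀ a b → SemilatticeOrMajority M a b)
    semilattice-majority = M , (λ i → preserves-ternary (op p) M-pres {R = rel 𝔸 i} (preserves p i) (unary⊎binary i)) , M-colour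
      where
      open Conservative conservative using (module Taylor)
      open Majority t conservative
        (Colouring.colours t conservative λ a≢b → Taylor.useful t-cong taylor-functions a≢b)

-- Meet semidistributivity from the identities.

module SDMeet {n} {𝔸 : RelStr n} {M : Fin n → Fin n → Fin n → Fin n}
  (M-preserves : ∀ i → Preserves (on-vectors M) (rel 𝔸 i))
  (colour : ∀ a b → SemilatticeOrMajority M a b)
  {ℓ} {B : Algebra 𝔸 ℓ} (B∈V : InVariety B) where

  open Identities colour

  Mᴾ : Pol 𝔸
  Mᴾ = pol 3 (on-vectors M) M-preserves

  Mᵀ : Term 𝔸 → Term 𝔸 → Term 𝔸 → Term 𝔸
  Mᵀ a b c = app Mᴾ λ { 0F → a ; 1F → b ; 2F → c }

  Fᵀ : Term 𝔸 → Term 𝔸 → Term 𝔸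
  Fᵀ a b = Mᵀ a a b

  C : Set ℓ
  C = Carrier B

  Mᴮ : C → C → C → C
  Mᴮ x y z = ⟦ B ⟧ Mᴾ (x ∷ y ∷ z ∷ [])

  Fᴮ : C → C → C
  Fᴮ x y = Mᴮ x x y

  module _ (x y : C) where
    private
      e : ℕ → C
      e zero = x
      e (suc _) = y
      X Y : Term 𝔸
      X = var 0
      Y = var 1

    Fᴮ-idem : Fᴮ x x ≡ x
    Fᴮ-idem = B∈V (Fᵀ X X) X (λ e → F-idem (e 0)) e

    Fᴮ-absorbˡ : Fᴮ x (Fᴮ x y) ≡ Fᴮ x y
    Fᴮ-absorbˡ = B∈V (Fᵀ X (Fᵀ X Y)) (Fᵀ X Y) (λ e → F-absorbˡ (e 0) (e 1)) e

    Fᴮ-absorbʳ : Fᴮ (Fᴮ x y) y ≡ Fᴮ x y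
    Fᴮ-absorbʳ = B∈V (Fᵀ (Fᵀ X Y) Y) (Fᵀ X Y) (λ e → F-absorbʳ (e 0) (e 1)) e

    Fᴮ-absorb : Fᴮ (Fᴮ x y) x ≡ Fᴮ x y
    Fᴮ-absorb = B∈V (Fᵀ (Fᵀ X Y) X) (Fᵀ X Y) (λ e → F-absorb (e 0) (e 1)) e

    Mᴮ-left : Mᴮ (Fᴮ x y) (Fᴮ y x) x ≡ Fᴮ x y
    Mᴮ-left = B∈V (Mᵀ (Fᵀ X Y) (Fᵀ Y X) X) (Fᵀ X Y) (λ e → M-left (e 0) (e 1)) e

    Mᴮ-right : Mᴮ (Fᴮ x y) (Fᴮ y x) y ≡ Fᴮ y x
    Mᴮ-right = B∈V (Mᵀ (Fᵀ X Y) (Fᵀ Y X) Y) (Fᵀ Y X) (λ e → M-right (e 0) (e 1)) e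

  -- The property of unary polynomials on which the chain argument rests.
  Congruent : (C → C) → Set _
  Congruent p = (κ : Congruence B) → ∀ {c c′} → θ κ c c′ → θ κ (p c) (p c′)

  module _ (κ : Congruence B) where
    open IsEquivalence (isEq κ) public using () renaming (refl to θ-refl; sym to θ-sym; trans to θ-trans; reflexive to θ-reflexive)

    M-cong : ∀ {x x′ y y′ z z′} → θ κ x x′ → θ κ y y′ → θ κ z z′ → θ κ (Mᴮ x y z) (Mᴮ x′ y′ z′)
    M-cong r s u = compat κ Mᴾ _ _ (r ∷ s ∷ u ∷ [])

    F-cong : ∀ {x x′ y y′} → θ κ x x′ → θ κ y y′ → θ κ (Fᴮ x y) (Fᴮ x′ y′)
    F-cong r s = M-cong r r s

  module _ {α β γ : Congruence B} (meets : (θ α ∧ᶜ θ β) ≐ (θ α ∧ᶜ θ γ)) where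

    -- This is α ∧ β in a symmetric form: by `meets`, α together with one of β and γ implies the
    -- other.
    Δ : C → C → Set ℓ
    Δ x y = θ α x y × θ β x y × θ γ x y

    Chain : C → C → Set ℓ
    Chain = θ β ∨ᶜ θ γ

    Δ-sym : ∀ {x y} → Δ x y → Δ y x
    Δ-sym (a , b , c) = θ-sym α a , θ-sym β b , θ-sym γ c

    Δ-trans : ∀ {x y z} → Δ x y → Δ y z → Δ x z
    Δ-trans (a , b , c) (a′ , b′ , c′) = θ-trans α a a′ , θ-trans β b b′ , θ-trans γ c c′

    Δ-reflexive : ∀ {x y} → x ≡ y → Δ x y
    Δ-reflexive refl = θ-refl α , θ-refl β , θ-refl γ

    -- Along a β-step, `p v`, `p u`, `q u` and `q v` are β-related in turn. As `p v` and `q v` are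
    -- also α-related, `meets` adds γ. The γ-steps are symmetric.
    chain-transfer : ∀ {p q} → Congruent p → Congruent q → (∀ c → θ α (p c) (q c)) →
      ∀ {u v} → Chain u v → Δ (p u) (q u) → Δ (p v) (q v)
    chain-transfer {p} {q} p-cong q-cong p∼q = go
      where
      step : ∀ {u v} → θ β u v ⊎ θ γ u v → Δ (p u) (q u) → Δ (p v) (q v)
      step (inj₁ r) (_ , b , _) = p∼q _ , b′ , proj₂ (proj₁ meets (p∼q _ , b′))
        where b′ = θ-trans β (θ-sym β (p-cong β r)) (θ-trans β b (q-cong β r))
      step (inj₂ r) (_ , _ , c) = p∼q _ , proj₂ (proj₂ meets (p∼q _ , c′)) , c′
        where c′ = θ-trans γ (θ-sym γ (p-cong γ r)) (θ-trans γ c (q-cong γ r))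
      go : ∀ {u v} → Chain u v → Δ (p u) (q u) → Δ (p v) (q v)
      go [ r ]   d = step r d
      go (r ∷ c) d = go c (step r d)

    module _ {a b : C} (a∼b : θ α a b) (chain : Chain a b) where

      -- At `a` both polynomials take the value `Fᴮ b a`; at `b` they take the two values to be
      -- related.
      Δ-F : Δ b (Fᴮ b a)
      Δ-F = subst₂ Δ (Fᴮ-idem b b) (trans (cong (Fᴮ (Fᴮ b a)) (Fᴮ-idem b b)) (Fᴮ-absorb b a))
        (chain-transfer {Fᴮ b} {λ c → Fᴮ (Fᴮ b a) (Fᴮ b c)}
          (λ κ → F-cong κ (θ-refl κ)) (λ κ r → F-cong κ (θ-refl κ) (F-cong κ (θ-refl κ) r))
          related chain (Δ-reflexive (sym (Fᴮ-idem (Fᴮ b a) b))))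
        where
        related : ∀ c → θ α (Fᴮ b c) (Fᴮ (Fᴮ b a) (Fᴮ b c))
        -- `Fᴮ b c` is rewritten as `Fᴮ (Fᴮ b b) (Fᴮ b c)`, and then the second `b` is replaced by
        -- `a` modulo α.
        related c = subst (λ x → θ α x (Fᴮ (Fᴮ b a) (Fᴮ b c)))
          (trans (cong (λ x → Fᴮ x (Fᴮ b c)) (Fᴮ-idem b b)) (Fᴮ-absorbˡ b c))
          (F-cong α (F-cong α (θ-refl α) (θ-sym α a∼b)) (θ-refl α))

      -- At `a` both polynomials give `Fᴮ a b`; at `b` the first gives `Fᴮ b a` and the second still
      -- `Fᴮ a b`.
      Δ-FF : Δ (Fᴮ b a) (Fᴮ a b)
      Δ-FF = subst₂ Δ (Mᴮ-right a b) (Fᴮ-absorbʳ a b)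
        (chain-transfer {Mᴮ (Fᴮ a b) (Fᴮ b a)} {Fᴮ (Fᴮ a b)}
          (λ κ → M-cong κ (θ-refl κ) (θ-refl κ)) (λ κ → F-cong κ (θ-refl κ))
          related chain (Δ-reflexive (trans (Mᴮ-left a b) (sym (Fᴮ-absorb a b)))))
        where
        related : ∀ c → θ α (Mᴮ (Fᴮ a b) (Fᴮ b a) c) (Fᴮ (Fᴮ a b) c)
        related c = M-cong α (θ-refl α)
          (F-cong α (θ-sym α a∼b) a∼b) (θ-refl α)

    -- The path runs through `a`, `Fᴮ a b`, `Fᴮ b a` and `b`; its first link uses the reversed
    -- chain.
    join-meet : ∀ {a b} → θ α a b → Chain a b → Δ a b
    join-meet a∼b chain = Δ-trans (Δ-F (θ-sym α a∼b) (symmetric _ (Sum.map (θ-sym β) (θ-sym γ)) chain))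
      (Δ-trans (Δ-sym (Δ-FF a∼b chain)) (Δ-sym (Δ-F a∼b chain)))

theorem8 : {n : ℕ} (𝔸 : RelStr n) → ThreeConservative 𝔸 → UnaryOrBinary 𝔸 →
    AdmitsTaylor 𝔸 → VarietySDmeet 𝔸
theorem8 𝔸 3-cons ub (p , taylor) = sd (semilattice-majority 𝔸 3-cons ub p taylor)
  where
  sd : Σ (Fin _ → Fin _ → Fin _ → Fin _) (λ M →
      (∀ i → Preserves (on-vectors M) (rel 𝔸 i)) × (∀ a b → SemilatticeOrMajority M a b)) →
    VarietySDmeet 𝔸
  sd (M , M-preserves , colour) B B∈V α β γ meets =
    (λ (a∼b , chain) → a∼b , proj₁ (proj₂ (join-meet {α} {β} {γ} meets a∼b chain))) ,
    (λ (a∼b , b∼) → a∼b , [ inj₁ b∼ ])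
    where open SDMeet M-preserves colour {B = B} B∈V
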